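{- Let $G_1$ be a simple connected graph, $v\in V(G_1)$, $k\ge2$, and let $G=G_1\oplus_vS_{k+1}$ be the graph obtained by attaching $k$ new pendant vertices to $v$ (the star $S_{k+1}$ with its central vertex identified with $v$). Let $\mathscr L$ be any set of $l\ge1$ pairs of distinct vertices of the star $S_{k+1}$ that are not edges (i.e. pairs of the new pendant vertices). Then $\mathscr L$ is a Braess set of $G$ provided $$|E(G_1)|>\begin{cases}\frac18\left[\sqrt{33l^2+50l+17}-l-1\right]&\text{if } l<k,\\[2pt] \frac18\left[\sqrt{33k^2-30k+1}-k-1\right]&\text{if } l\ge k.\end{cases}$$
   Context: For connected $H$ with $m\ge1$ edges and degrees $d_i$, Kemeny's constant is $\mathscr{K}(H)=\sum_j\pi_jm_{ij}$ for the simple random walk on $H$ ($\pi_j=d_j/2m$, $m_{ij}$ expected hitting time of $j$ from $i$, $m_{jj}=0$), equivalently $\frac1{4m}\sum_{i,j}d_id_jr_H(i,j)$ with $r_H$ effective resistance. A Braess set of a graph $G$ is a set of non-edges of $G$ such that adding all of them to $G$ strictly increases Kemeny's constant. -}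

module Defs where

open import Data.Nat as ℕ using (ℕ; zero; suc)
open import Data.Integer using (+_)
open import Data.Rational as ℚ using (ℚ; 0ℚ; 1ℚ; _/_)
open import Data.Fin as Fin using (Fin; splitAt; toℕ)
open import Data.Fin.Properties using (_≟_)
open import Data.Bool using (Bool; true; false; _∧_; _∨_; if_then_else_)
open import Data.Sum using (_⊎_; inj₁; inj₂)
open import Data.Product using (_×_; _,_)
open import Data.List using (List; []; _∷_)
open import Relation.Nullary using (¬_; does)
open import Relation.Binary.PropositionalEquality using (_≡_; _≢_)

Adj : ℕ → Set
Adj n = Fin n → Fin n → Bool

record IsSimple {n : ℕ} (adj : Adj n) : Set where
  field
    symmetric   : ∀ i j → adj i j ≡ adj j i
    irreflexive : ∀ i → adj i i ≡ false

data Walk {n : ℕ} (adj : Adj n) : Fin n → Fin n → Set where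
  here  : ∀ {i} → Walk adj i i
  step  : ∀ {i j k} → adj i j ≡ true → Walk adj j k → Walk adj i k

Connected : {n : ℕ} → Adj n → Set
Connected {n} adj = ∀ (i j : Fin n) → Walk adj i j

Σℕ : (n : ℕ) → (Fin n → ℕ) → ℕ
Σℕ zero    f = 0
Σℕ (suc n) f = f Fin.zero ℕ.+ Σℕ n (λ i → f (Fin.suc i))

Σℚ : (n : ℕ) → (Fin n → ℚ) → ℚ
Σℚ zero    f = 0ℚ
Σℚ (suc n) f = f Fin.zero ℚ.+ Σℚ n (λ i → f (Fin.suc i))

b2ℕ : Bool → ℕ
b2ℕ true  = 1
b2ℕ false = 0

ℕ→ℚ : ℕ → ℚ
ℕ→ℚ k = + k / 1

deg : {n : ℕ} → Adj n → Fin n → ℕ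
deg {n} adj i = Σℕ n (λ j → b2ℕ (adj i j))

edges : {n : ℕ} → Adj n → ℕ
edges {n} adj = Σℕ n (λ i → Σℕ n (λ j → b2ℕ (adj i j ∧ does (toℕ i ℕ.<? toℕ j))))

-- 1/k as a rational (with the harmless convention 1/0 = 0)
inv : ℕ → ℚ
inv zero    = 0ℚ
inv (suc k) = + 1 / suc k

-- M i j are the expected hitting times of j from i for the simple random
-- walk on adj: the (unique, for connected graphs) solution of
--   m_jj = 0,   m_ij = 1 + Σ_k P_ik m_kj  (i ≠ j),  P_ik = [i~k]/d_i,
-- written multiplied through by d_i.
IsHittingTimes : {n : ℕ} → Adj n → (Fin n → Fin n → ℚ) → Set
IsHittingTimes {n} adj M =
  (∀ j → M j j ≡ 0ℚ) ×
  (∀ i j → i ≢ j →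
     ℕ→ℚ (deg adj i) ℚ.* M i j
       ≡ ℕ→ℚ (deg adj i) ℚ.+ Σℚ n (λ k → ℕ→ℚ (b2ℕ (adj i k)) ℚ.* M k j))

stat : {n : ℕ} → Adj n → Fin n → ℚ
stat adj j = ℕ→ℚ (deg adj j) ℚ.* inv (2 ℕ.* edges adj)

kemenyFrom : {n : ℕ} → (adj : Adj n) → (Fin n → Fin n → ℚ) → Fin n → ℚ
kemenyFrom {n} adj M i = Σℚ n (λ j → stat adj j ℚ.* M i j)

KemenyIncreases : {n : ℕ} → Adj n → Adj n → Set
KemenyIncreases {n} adj adj' =
  ∀ (M M' : Fin n → Fin n → ℚ) → IsHittingTimes adj M → IsHittingTimes adj' M' →
  ∀ (i i' : Fin n) → kemenyFrom adj M i ℚ.< kemenyFrom adj' M' i'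

attachStar : {n : ℕ} (k : ℕ) → Adj n → Fin n → Adj (n ℕ.+ k)
attachStar {n} k adj v x y with splitAt n x | splitAt n y
... | inj₁ a | inj₁ b = adj a b
... | inj₁ a | inj₂ _ = does (a ≟ v)
... | inj₂ _ | inj₁ b = does (b ≟ v)
... | inj₂ _ | inj₂ _ = false

memPair : {k : ℕ} → List (Fin k × Fin k) → Fin k → Fin k → Bool
memPair []             p q = false
memPair ((a , b) ∷ L) p q =
  (does (a ≟ p) ∧ does (b ≟ q)) ∨ (does (a ≟ q) ∧ does (b ≟ p)) ∨ memPair L p q

addPendantPairs : {n k : ℕ} → Adj (n ℕ.+ k) → List (Fin k × Fin k) → Adj (n ℕ.+ k)
addPendantPairs {n} {k} adj L x y with splitAt n x | splitAt n y
... | inj₂ p | inj₂ q = adj x y ∨ memPair L p q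
... | _      | _      = adj x y

SamePair : {k : ℕ} → Fin k × Fin k → Fin k × Fin k → Set
SamePair (a , b) (c , d) = (a ≡ c × b ≡ d) ⊎ (a ≡ d × b ≡ c)

{-# OPTIONS --safe #-}
-- Let H be the graph formed by the l new edges on the k pendant vertices, h p the degree of p in H, and
-- Λ = I + (Laplacian of H). For a connected graph of total degree V, Kemeny's constant equals
-- Σ_j d_j r(v,j) − (1/V) Σ_j d_j τ(j,v), with r the effective resistance and τ the expected hitting time. For vertices j
-- of G₁ neither r(v,j) nor τ(j,v) changes when pairs are added, and Σ_{j ∈ G₁} d_j τ(j,v) ≥ m = |E(G₁)|.
-- Subtracting, the increase is positive as soon as 2(m + k + l) s > 3l + t, where
-- s = Σ_p ((1 + h p) Q p p − 1) with Q the inverse of Λ, and t = hᵀ Q h. Two test vectors in the variational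
-- characterisation of Q p p give t ≤ (k + 2l) s and h p ≤ (μ + 1) ((1 + h p) Q p p − 1), where μ bounds the size of
-- the component of p, so s ≥ 2l / (μ + 1). It remains that 3 (μ + 1) < 2 (2m + k) with μ = min(k, l + 1), which
-- follows from the hypothesis on m.
module Submission where

open import Defs

-- Grounding the Laplacian at `v` makes it block diagonal: one block belongs to G₁ and is common to
-- both graphs, the other is Λ, whose identity part comes from the pendant edges. The new graph then
-- enters only through l, s and t. Its Q has no usable closed form, since the set of pairs is
-- arbitrary, but s is linear in the diagonal of Q, so lower bounds for Q p p suffice. The test
-- vector δ_p alone yields Q p p ≥ 1 / (1 + h p), which says only s ≥ 0; both test vectors are
-- perturbations of it, scaled so that no division occurs. The new total degree splits as 2(m + k +
-- l) = (k + 2l) + (2m + k). The first summand times s pays for t, the second for 3l. No matrix is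
-- inverted. Hitting times are an arbitrary rational solution of their equations; the Green
-- functions are read off from them by the commute time identity, and the G₁ parts of the two graphs
-- are identified by uniqueness. The hypothesis forces m to exceed roughly 0.6 min(l, k), whereas
-- the last inequality asks for little more than a quarter of it. Only for very small l or k is
-- there no room, and there m being an integer decides.

-- The embedding of ℕ into ℚ and rules for signs.

module RationalArithmetic where
  open import Data.Nat as ℕ using (ℕ; zero; suc)
  import Data.Nat.Properties as ℕ
  import Data.Integer as ℤ
  import Data.Integer.Properties as ℤ
  open import Data.Rational using (0ℚ; 1ℚ; _+_; _*_; _-_; -_; _≤_; _<_; toℚᵘ; nonNegative; positive)
  open import Data.Rational.Unnormalised as ℚᵘ using (mkℚᵘ; *≡*)
  import Data.Rational.Unnormalised.Properties as ℚᵘ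
  open import Data.Rational.Properties
  open import Data.Rational.Solver using (module +-*-Solver)
  open +-*-Solver using (solve; _:+_; _:*_; _:-_; :-_; _:=_; con)
  open import Data.Sum using (inj₁; inj₂)
  open import Relation.Binary.PropositionalEquality using (_≡_; refl; sym; trans; cong; cong₂; subst)

  ℕ→ℚ-homo-+ : ∀ a b → ℕ→ℚ (a ℕ.+ b) ≡ ℕ→ℚ a + ℕ→ℚ b
  ℕ→ℚ-homo-+ a b = toℚᵘ-injective (begin
    toℚᵘ (ℕ→ℚ (a ℕ.+ b))                    ≈⟨ toℚᵘ-fromℚᵘ (mkℚᵘ (ℤ.+ (a ℕ.+ b)) 0) ⟩
    mkℚᵘ (ℤ.+ (a ℕ.+ b)) 0                     ≈⟨ *≡* (cong₂ (λ x y → (x ℤ.+ y) ℤ.* (ℤ.+ 1)) (sym (ℤ.*-identityʳ (ℤ.+ a))) (sym (ℤ.*-identityʳ (ℤ.+ b)))) ⟩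
    mkℚᵘ (ℤ.+ a) 0 ℚᵘ.+ mkℚᵘ (ℤ.+ b) 0           ≈⟨ ℚᵘ.+-cong (toℚᵘ-fromℚᵘ (mkℚᵘ (ℤ.+ a) 0)) (toℚᵘ-fromℚᵘ (mkℚᵘ (ℤ.+ b) 0)) ⟨
    toℚᵘ (ℕ→ℚ a) ℚᵘ.+ toℚᵘ (ℕ→ℚ b)          ≈⟨ toℚᵘ-homo-+ (ℕ→ℚ a) (ℕ→ℚ b) ⟨
    toℚᵘ (ℕ→ℚ a + ℕ→ℚ b)                    ∎)
    where open ℚᵘ.≃-Reasoning

  ℕ→ℚ-homo-* : ∀ a b → ℕ→ℚ (a ℕ.* b) ≡ ℕ→ℚ a * ℕ→ℚ b
  ℕ→ℚ-homo-* zero    b = sym (*-zeroˡ (ℕ→ℚ b))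
  ℕ→ℚ-homo-* (suc a) b = trans (ℕ→ℚ-homo-+ b (a ℕ.* b))
    (trans (cong (ℕ→ℚ b +_) (ℕ→ℚ-homo-* a b))
    (trans (solve 2 (λ a b → b :+ a :* b := (con 1ℚ :+ a) :* b) refl (ℕ→ℚ a) (ℕ→ℚ b))
           (cong (_* ℕ→ℚ b) (sym (ℕ→ℚ-homo-+ 1 a)))))

  0≤ℕ→ℚ : ∀ a → 0ℚ ≤ ℕ→ℚ a
  0≤ℕ→ℚ a = nonNegative⁻¹ (ℕ→ℚ a) {{normalize-nonNeg a 1}}

  0<ℕ→ℚ : ∀ {a} → 1 ℕ.≤ a → 0ℚ < ℕ→ℚ a
  0<ℕ→ℚ {suc a} _ = positive⁻¹ (ℕ→ℚ (suc a)) {{normalize-pos (suc a) 1}}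

  inv-inverseʳ : ∀ {a} → 1 ℕ.≤ a → ℕ→ℚ a * inv a ≡ 1ℚ
  inv-inverseʳ {suc a} _ = toℚᵘ-injective (begin
    toℚᵘ (ℕ→ℚ (suc a) * inv (suc a))             ≈⟨ toℚᵘ-homo-* (ℕ→ℚ (suc a)) (inv (suc a)) ⟩
    toℚᵘ (ℕ→ℚ (suc a)) ℚᵘ.* toℚᵘ (inv (suc a))   ≈⟨ ℚᵘ.*-cong (toℚᵘ-fromℚᵘ (mkℚᵘ (ℤ.+ suc a) 0)) (toℚᵘ-fromℚᵘ (mkℚᵘ (ℤ.+ 1) a)) ⟩
    mkℚᵘ (ℤ.+ suc a) 0 ℚᵘ.* mkℚᵘ (ℤ.+ 1) a           ≈⟨ *≡* (trans (ℤ.*-identityʳ (ℤ.+ suc a ℤ.* (ℤ.+ 1))) (trans (ℤ.*-identityʳ (ℤ.+ suc a)) (trans (cong (λ x → ℤ.+ suc x) (sym (ℕ.+-identityʳ a))) (sym (ℤ.*-identityˡ (ℤ.+ (1 ℕ.* suc a))))))) ⟩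
    toℚᵘ 1ℚ                                       ∎)
    where open ℚᵘ.≃-Reasoning

  0≤1 : 0ℚ ≤ 1ℚ
  0≤1 = 0≤ℕ→ℚ 1

  0≤a+b : ∀ {a b} → 0ℚ ≤ a → 0ℚ ≤ b → 0ℚ ≤ a + b
  0≤a+b p q = +-mono-≤ p q

  0≤a*b : ∀ {a b} → 0ℚ ≤ a → 0ℚ ≤ b → 0ℚ ≤ a * b
  0≤a*b {a} {b} p q = nonNegative⁻¹ (a * b) {{nonNeg*nonNeg⇒nonNeg a {{nonNegative p}} b {{nonNegative q}}}}

  0<a*b : ∀ {a b} → 0ℚ < a → 0ℚ < b → 0ℚ < a * b
  0<a*b {a} {b} p q = positive⁻¹ (a * b) {{pos*pos⇒pos a {{positive p}} b {{positive q}}}}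

  0≤b-a : ∀ {a b} → a ≤ b → 0ℚ ≤ b - a
  0≤b-a {a} {b} p = subst (_≤ b - a) (+-inverseʳ a) (+-monoˡ-≤ (- a) p)

  0<b-a : ∀ {a b} → a < b → 0ℚ < b - a
  0<b-a {a} {b} p = subst (_< b - a) (+-inverseʳ a) (+-monoˡ-< (- a) p)

  0≤b-a⇒a≤b : ∀ {a b} → 0ℚ ≤ b - a → a ≤ b
  0≤b-a⇒a≤b {a} {b} p = subst (_≤ b) (+-identityˡ a)
    (subst (0ℚ + a ≤_) (solve 2 (λ a b → b :- a :+ a := b) refl a b) (+-monoˡ-≤ a p))

  0<b-a⇒a<b : ∀ {a b} → 0ℚ < b - a → a < b
  0<b-a⇒a<b {a} {b} p = subst (_< b) (+-identityˡ a)
    (subst (0ℚ + a <_) (solve 2 (λ a b → b :- a :+ a := b) refl a b) (+-monoˡ-< a p))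

  a≤a+b : ∀ {a b c} → 0ℚ ≤ b → a + b ≡ c → a ≤ c
  a≤a+b {a} {b} 0≤b refl = subst (_≤ a + b) (+-identityʳ a) (+-monoʳ-≤ a 0≤b)

  0≤a*a : ∀ a → 0ℚ ≤ a * a
  0≤a*a a with ≤-total 0ℚ a
  ... | inj₁ p = 0≤a*b p p
  ... | inj₂ p = subst (0ℚ ≤_) (solve 1 (λ a → (:- a) :* (:- a) := a :* a) refl a) (0≤a*b 0≤-a 0≤-a)
    where
    0≤-a : 0ℚ ≤ - a
    0≤-a = neg-antimono-≤ p

  0≤a*b⇒0≤b : ∀ {a b} → 0ℚ < a → 0ℚ ≤ a * b → 0ℚ ≤ b
  0≤a*b⇒0≤b {a} {b} p q = *-cancelˡ-≤-pos a {{positive p}} (subst (_≤ a * b) (sym (*-zeroʳ a)) q)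

  0<a*b⇒0<b : ∀ {a b} → 0ℚ < a → 0ℚ < a * b → 0ℚ < b
  0<a*b⇒0<b {a} {b} p q = *-cancelˡ-<-nonNeg a {{nonNegative (<⇒≤ p)}} (subst (_< a * b) (sym (*-zeroʳ a)) q)

  ℕ→ℚ-mono-< : ∀ {a b} → a ℕ.< b → ℕ→ℚ a < ℕ→ℚ b
  ℕ→ℚ-mono-< {a} {b} p = 0<b-a⇒a<b (subst (0ℚ <_)
    (trans (solve 2 (λ a c → c := a :+ c :- a) refl (ℕ→ℚ a) (ℕ→ℚ (b ℕ.∸ a)))
      (cong (_- ℕ→ℚ a) (trans (sym (ℕ→ℚ-homo-+ a (b ℕ.∸ a))) (cong ℕ→ℚ (ℕ.m+[n∸m]≡n (ℕ.<⇒≤ p))))))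
    (0<ℕ→ℚ (ℕ.m<n⇒0<n∸m p)))

-- Finite rational sums, indicators and the Kronecker delta.

module FiniteSums where
  open RationalArithmetic
  open import Data.Nat as ℕ using (ℕ; zero; suc)
  open import Data.Fin using (Fin; zero; suc; _↑ˡ_; _↑ʳ_)
  open import Data.Fin.Properties using (_≟_)
  open import Data.Bool using (Bool; true; false)
  open import Data.Rational using (ℚ; 0ℚ; 1ℚ; _+_; _*_; _-_; -_; _≤_)
  open import Data.Rational.Properties using (+-identityˡ; +-identityʳ; *-zeroˡ; *-identityˡ; +-assoc; +-mono-≤; ≤-refl)
  open import Data.Rational.Solver using (module +-*-Solver)
  open +-*-Solver using (solve; _:+_; _:*_; _:-_; :-_; _:=_; con)
  open import Relation.Binary.PropositionalEquality using (_≡_; _≢_; refl; sym; trans; cong; cong₂; subst)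
  open import Relation.Nullary using (does; yes; no)
  open import Data.Empty using (⊥-elim)

  private variable
    n : ℕ

  Σ-cong : {f g : Fin n → ℚ} → (∀ i → f i ≡ g i) → Σℚ n f ≡ Σℚ n g
  Σ-cong {zero}  e = refl
  Σ-cong {suc n} e = cong₂ _+_ (e zero) (Σ-cong (λ i → e (suc i)))

  Σ-zero : ∀ n → Σℚ n (λ _ → 0ℚ) ≡ 0ℚ
  Σ-zero zero    = refl
  Σ-zero (suc n) = trans (+-identityˡ _) (Σ-zero n)

  Σ-*+ : ∀ c (f g : Fin n → ℚ) → Σℚ n (λ i → c * f i + g i) ≡ c * Σℚ n f + Σℚ n g
  Σ-*+ {zero}  c f g = solve 1 (λ c → con 0ℚ := c :* con 0ℚ :+ con 0ℚ) refl c
  Σ-*+ {suc n} c f g = trans (cong ((c * f zero + g zero) +_) (Σ-*+ c (λ i → f (suc i)) (λ i → g (suc i))))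
    (solve 5 (λ c a b x y → (c :* a :+ b) :+ (c :* x :+ y) := c :* (a :+ x) :+ (b :+ y)) refl c _ _ _ _)

  Σ-+ : (f g : Fin n → ℚ) → Σℚ n (λ i → f i + g i) ≡ Σℚ n f + Σℚ n g
  Σ-+ {n} f g = trans (Σ-cong (λ i → cong (_+ g i) (sym (*-identityˡ (f i)))))
    (trans (Σ-*+ 1ℚ f g) (cong (_+ Σℚ n g) (*-identityˡ (Σℚ n f))))

  Σ-* : ∀ c (f : Fin n → ℚ) → Σℚ n (λ i → c * f i) ≡ c * Σℚ n f
  Σ-* {n} c f = trans (Σ-cong (λ i → sym (+-identityʳ (c * f i))))
    (trans (Σ-*+ c f (λ _ → 0ℚ)) (trans (cong (c * Σℚ n f +_) (Σ-zero n)) (+-identityʳ _)))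

  Σ-- : (f g : Fin n → ℚ) → Σℚ n (λ i → f i - g i) ≡ Σℚ n f - Σℚ n g
  Σ-- {n} f g = trans (Σ-cong (λ i → solve 2 (λ a b → a :- b := con (- 1ℚ) :* b :+ a) refl (f i) (g i)))
    (trans (Σ-*+ (- 1ℚ) g f) (solve 2 (λ a b → con (- 1ℚ) :* b :+ a := a :- b) refl (Σℚ n f) (Σℚ n g)))

  Σ-const : ∀ n c → Σℚ n (λ _ → c) ≡ ℕ→ℚ n * c
  Σ-const zero    c = sym (*-zeroˡ c)
  Σ-const (suc n) c = trans (cong (c +_) (Σ-const n c))
    (trans (solve 2 (λ n c → c :+ n :* c := (con 1ℚ :+ n) :* c) refl (ℕ→ℚ n) c)
           (cong (_* c) (sym (ℕ→ℚ-homo-+ 1 n))))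

  Σ-swap : ∀ {m} (f : Fin m → Fin n → ℚ) → Σℚ m (λ i → Σℚ n (f i)) ≡ Σℚ n (λ j → Σℚ m (λ i → f i j))
  Σ-swap {n} {zero}  f = sym (Σ-zero n)
  Σ-swap {n} {suc m} f = trans (cong (Σℚ n (f zero) +_) (Σ-swap (λ i → f (suc i))))
    (sym (Σ-+ (f zero) (λ j → Σℚ m (λ i → f (suc i) j))))

  Σ-mono : {f g : Fin n → ℚ} → (∀ i → f i ≤ g i) → Σℚ n f ≤ Σℚ n g
  Σ-mono {zero}  p = ≤-refl
  Σ-mono {suc n} p = +-mono-≤ (p zero) (Σ-mono (λ i → p (suc i)))

  0≤Σ : {f : Fin n → ℚ} → (∀ i → 0ℚ ≤ f i) → 0ℚ ≤ Σℚ n f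
  0≤Σ {n} {f} p = subst (_≤ Σℚ n f) (Σ-zero n) (Σ-mono p)

  Σ-split : ∀ m (f : Fin (m ℕ.+ n) → ℚ) → Σℚ (m ℕ.+ n) f ≡ Σℚ m (λ i → f (i ↑ˡ n)) + Σℚ n (λ j → f (m ↑ʳ j))
  Σ-split zero    f = sym (+-identityˡ _)
  Σ-split (suc m) f = trans (cong (f zero +_) (Σ-split m (λ i → f (suc i)))) (sym (+-assoc (f zero) _ _))

  bit : Bool → ℚ
  bit true  = 1ℚ
  bit false = 0ℚ

  0≤bit : ∀ b → 0ℚ ≤ bit b
  0≤bit true  = 0≤1
  0≤bit false = ≤-refl

  ℕ→ℚ-b2ℕ : ∀ b → ℕ→ℚ (b2ℕ b) ≡ bit b
  ℕ→ℚ-b2ℕ true  = refl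
  ℕ→ℚ-b2ℕ false = refl

  bit*bit : ∀ b → bit b * bit b ≡ bit b
  bit*bit true  = refl
  bit*bit false = refl

  δ : Fin n → Fin n → ℚ
  δ i j = bit (does (i ≟ j))

  δ-refl : (i : Fin n) → δ i i ≡ 1ℚ
  δ-refl i with i ≟ i
  ... | yes _ = refl
  ... | no ne = ⊥-elim (ne refl)

  δ-≢ : {i j : Fin n} → i ≢ j → δ i j ≡ 0ℚ
  δ-≢ {i = i} {j} ne with i ≟ j
  ... | yes e = ⊥-elim (ne e)
  ... | no _  = refl

  δ-sym : (i j : Fin n) → δ i j ≡ δ j i
  δ-sym i j with i ≟ j | j ≟ i
  ... | yes _ | yes _ = refl
  ... | no _  | no _  = refl
  ... | yes e | no ne = ⊥-elim (ne (sym e))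
  ... | no ne | yes e = ⊥-elim (ne (sym e))

  δ-suc : (i j : Fin n) → δ (suc i) (suc j) ≡ δ i j
  δ-suc i j with i ≟ j
  ... | yes _ = refl
  ... | no _  = refl

  Σ-δ : (i : Fin n) (f : Fin n → ℚ) → Σℚ n (λ j → δ i j * f j) ≡ f i
  Σ-δ {suc n} zero f = trans (cong₂ _+_ (*-identityˡ (f zero)) (trans (Σ-cong (λ j → *-zeroˡ (f (suc j)))) (Σ-zero n)))
    (+-identityʳ (f zero))
  Σ-δ {suc n} (suc i) f = trans (cong₂ _+_ (*-zeroˡ (f zero))
    (trans (Σ-cong (λ j → cong (_* f (suc j)) (δ-suc i j))) (Σ-δ i (λ j → f (suc j))))) (+-identityˡ _)

  Σ-ℕ→ℚ : (f : Fin n → ℕ) → ℕ→ℚ (Σℕ n f) ≡ Σℚ n (λ i → ℕ→ℚ (f i))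
  Σ-ℕ→ℚ {zero}  f = refl
  Σ-ℕ→ℚ {suc n} f = trans (ℕ→ℚ-homo-+ (f zero) _) (cong (ℕ→ℚ (f zero) +_) (Σ-ℕ→ℚ (λ i → f (suc i))))

-- The weighted Laplacian: energy form and minimum principle.

module Laplacian where
  open RationalArithmetic
  open FiniteSums
  open import Data.Nat as ℕ using (ℕ; zero; suc)
  open import Data.Fin using (Fin; zero; suc)
  open import Data.Fin.Properties using (_≟_)
  open import Data.Product using (∃; _,_)
  open import Data.Sum using (inj₁; inj₂)
  open import Data.Rational using (ℚ; 0ℚ; 1ℚ; _+_; _*_; _-_; -_; _≤_)
  open import Data.Rational.Properties using (+-identityˡ; +-identityʳ; *-zeroʳ; *-identityˡ; ≤-trans; ≤-refl; ≤-reflexive; ≤-total; ≤-antisym; +-monoˡ-≤; +-monoʳ-≤)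
  open import Data.Rational.Solver using (module +-*-Solver)
  open +-*-Solver using (solve; _:+_; _:*_; _:-_; :-_; _:=_; con)
  open import Relation.Binary.PropositionalEquality using (_≡_; _≢_; refl; sym; trans; cong; cong₂; subst; module ≡-Reasoning)
  open import Relation.Nullary using (yes; no)

  private variable
    n : ℕ

  Δ : (Fin n → Fin n → ℚ) → (Fin n → ℚ) → Fin n → ℚ
  Δ {n} w f i = Σℚ n (λ j → w i j * (f i - f j))

  module _ (w : Fin n → Fin n → ℚ) where

    Δ-expand : (f : Fin n → ℚ) (i : Fin n) → Δ w f i ≡ Σℚ n (w i) * f i - Σℚ n (λ j → w i j * f j)
    Δ-expand f i = trans
      (Σ-cong (λ j → solve 3 (λ w a b → w :* (a :- b) := a :* w :- w :* b) refl (w i j) (f i) (f j)))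
      (trans (Σ-- (λ j → f i * w i j) (λ j → w i j * f j))
      (cong (_- Σℚ n (λ j → w i j * f j))
        (trans (Σ-* (f i) (w i)) (solve 2 (λ a b → a :* b := b :* a) refl (f i) (Σℚ n (w i))))))

    Δ-linear : ∀ a (f : Fin n → ℚ) b (g : Fin n → ℚ) i → Δ w (λ j → a * f j + b * g j) i ≡ a * Δ w f i + b * Δ w g i
    Δ-linear a f b g i = trans
      (Σ-cong (λ j → solve 7 (λ w a b x y z t → w :* (a :* x :+ b :* y :- (a :* z :+ b :* t))
          := a :* (w :* (x :- z)) :+ b :* (w :* (y :- t))) refl (w i j) a b (f i) (g i) (f j) (g j)))
      (trans (Σ-*+ a (λ j → w i j * (f i - f j)) (λ j → b * (w i j * (g i - g j))))
        (cong (a * Δ w f i +_) (Σ-* b (λ j → w i j * (g i - g j)))))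

    module _ (w-sym : ∀ i j → w i j ≡ w j i) where

      Σ-gΔf : (f g : Fin n → ℚ) → Σℚ n (λ i → g i * Δ w f i) ≡ Σℚ n (λ i → Σℚ n (λ j → w i j * (g i * (f i - f j))))
      Σ-gΔf f g = Σ-cong (λ i → trans (sym (Σ-* (g i) (λ j → w i j * (f i - f j))))
        (Σ-cong (λ j → solve 3 (λ g w d → g :* (w :* d) := w :* (g :* d)) refl (g i) (w i j) (f i - f j))))

      Σ-w-swap : ∀ (F : Fin n → Fin n → ℚ) → Σℚ n (λ i → Σℚ n (λ j → w i j * F i j)) ≡ Σℚ n (λ i → Σℚ n (λ j → w i j * F j i))
      Σ-w-swap F = trans (Σ-swap (λ i j → w i j * F i j)) (Σ-cong (λ i → Σ-cong (λ j → cong (_* F j i) (w-sym j i))))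

      -- Both sides equal ΣΣ w i j g i f i − ΣΣ w i j g i f j, and the last sum is symmetric in f and g.
      Δ-selfAdjoint : (f g : Fin n → ℚ) → Σℚ n (λ i → g i * Δ w f i) ≡ Σℚ n (λ i → f i * Δ w g i)
      Δ-selfAdjoint f g = begin
        Σℚ n (λ i → g i * Δ w f i)                                   ≡⟨ Σ-gΔf f g ⟩
        S (λ i j → g i * (f i - f j))                                ≡⟨ S-cong (λ i j → solve 3 (λ g f h → g :* (f :- h) := g :* f :- g :* h) refl (g i) (f i) (f j)) ⟩
        S (λ i j → g i * f i - g i * f j)                            ≡⟨ S-- (λ i j → g i * f i) (λ i j → g i * f j) ⟩
        S (λ i j → g i * f i) - S (λ i j → g i * f j)                ≡⟨ cong (λ x → S (λ i j → g i * f i) - x) (Σ-w-swap (λ i j → g i * f j)) ⟩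
        S (λ i j → g i * f i) - S (λ i j → g j * f i)                ≡⟨ S-- (λ i j → g i * f i) (λ i j → g j * f i) ⟨
        S (λ i j → g i * f i - g j * f i)                            ≡⟨ S-cong (λ i j → solve 3 (λ g f h → g :* f :- h :* f := f :* (g :- h)) refl (g i) (f i) (g j)) ⟩
        S (λ i j → f i * (g i - g j))                                ≡⟨ Σ-gΔf g f ⟨
        Σℚ n (λ i → f i * Δ w g i)                                   ∎
        where
        open ≡-Reasoning
        S : (Fin n → Fin n → ℚ) → ℚ
        S F = Σℚ n (λ i → Σℚ n (λ j → w i j * F i j))
        S-cong : ∀ {F G : Fin n → Fin n → ℚ} → (∀ i j → F i j ≡ G i j) → S F ≡ S G
        S-cong e = Σ-cong (λ i → Σ-cong (λ j → cong (w i j *_) (e i j)))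
        S-- : ∀ F G → S (λ i j → F i j - G i j) ≡ S F - S G
        S-- F G = trans
          (Σ-cong (λ i → trans (Σ-cong (λ j → solve 3 (λ w a b → w :* (a :- b) := w :* a :- w :* b) refl (w i j) (F i j) (G i j)))
                               (Σ-- (λ j → w i j * F i j) (λ j → w i j * G i j))))
          (Σ-- (λ i → Σℚ n (λ j → w i j * F i j)) (λ i → Σℚ n (λ j → w i j * G i j)))

      Σ-Δ : ∀ f → Σℚ n (Δ w f) ≡ 0ℚ
      Σ-Δ f = begin
        Σℚ n (Δ w f)                          ≡⟨ Σ-cong (λ i → sym (*-identityˡ (Δ w f i))) ⟩
        Σℚ n (λ i → 1ℚ * Δ w f i)             ≡⟨ Δ-selfAdjoint f (λ _ → 1ℚ) ⟩
        Σℚ n (λ i → f i * Δ w (λ _ → 1ℚ) i)   ≡⟨ Σ-cong (λ i → trans (cong (f i *_) (Δ-1 i)) (*-zeroʳ (f i))) ⟩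
        Σℚ n (λ i → 0ℚ)                       ≡⟨ Σ-zero n ⟩
        0ℚ                                    ∎
        where
        open ≡-Reasoning
        Δ-1 : ∀ i → Δ w (λ _ → 1ℚ) i ≡ 0ℚ
        Δ-1 i = trans (Σ-cong (λ j → *-zeroʳ (w i j))) (Σ-zero n)

      -- Twice the sum is ΣΣ w i j (f i − f j)².
      Δ-nonNegative : (∀ i j → 0ℚ ≤ w i j) → ∀ f → 0ℚ ≤ Σℚ n (λ i → f i * Δ w f i)
      Δ-nonNegative 0≤w f = 0≤a*b⇒0≤b {1ℚ + 1ℚ} (0<ℕ→ℚ {2} (ℕ.s≤s ℕ.z≤n))
        (subst (0ℚ ≤_) (sym double) (0≤Σ (λ i → 0≤Σ (λ j → 0≤a*b (0≤w i j) (0≤a*a (f i - f j))))))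
        where
        open ≡-Reasoning
        E = Σℚ n (λ i → f i * Δ w f i)
        F : Fin n → Fin n → ℚ
        F i j = f i * (f i - f j)
        double : (1ℚ + 1ℚ) * E ≡ Σℚ n (λ i → Σℚ n (λ j → w i j * ((f i - f j) * (f i - f j))))
        double = begin
          (1ℚ + 1ℚ) * E  ≡⟨ solve 1 (λ e → (con 1ℚ :+ con 1ℚ) :* e := e :+ e) refl E ⟩
          E + E          ≡⟨ cong₂ _+_ (Σ-gΔf f f) (trans (Σ-gΔf f f) (Σ-w-swap F)) ⟩
          Σℚ n (λ i → Σℚ n (λ j → w i j * F i j)) + Σℚ n (λ i → Σℚ n (λ j → w i j * F j i))
            ≡⟨ Σ-+ (λ i → Σℚ n (λ j → w i j * F i j)) (λ i → Σℚ n (λ j → w i j * F j i)) ⟨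
          Σℚ n (λ i → Σℚ n (λ j → w i j * F i j) + Σℚ n (λ j → w i j * F j i))
            ≡⟨ Σ-cong (λ i → trans (sym (Σ-+ (λ j → w i j * F i j) (λ j → w i j * F j i)))
                 (Σ-cong (λ j → solve 3 (λ w a b → w :* (a :* (a :- b)) :+ w :* (b :* (b :- a)) := w :* ((a :- b) :* (a :- b))) refl (w i j) (f i) (f j)))) ⟩
          Σℚ n (λ i → Σℚ n (λ j → w i j * ((f i - f j) * (f i - f j)))) ∎

  -- The Laplacian of the cone over `w`, acting on functions that vanish at the apex: the summand
  -- `f i` is the unit edge from `i` to the apex.
  Λ : (Fin n → Fin n → ℚ) → (Fin n → ℚ) → Fin n → ℚ
  Λ w f i = f i + Δ w f i

  ⟨_,_⟩ : (Fin n → ℚ) → (Fin n → ℚ) → ℚ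
  ⟨_,_⟩ {n} f g = Σℚ n (λ i → f i * g i)

  ⟨⟩-linearˡ : ∀ a (f : Fin n → ℚ) b g h → ⟨ (λ i → a * f i + b * g i) , h ⟩ ≡ a * ⟨ f , h ⟩ + b * ⟨ g , h ⟩
  ⟨⟩-linearˡ a f b g h = trans
    (Σ-cong (λ i → solve 5 (λ a f b g h → (a :* f :+ b :* g) :* h := a :* (f :* h) :+ b :* (g :* h)) refl a (f i) b (g i) (h i)))
    (trans (Σ-*+ a (λ i → f i * h i) (λ i → b * (g i * h i))) (cong (a * ⟨ f , h ⟩ +_) (Σ-* b (λ i → g i * h i))))

  ⟨⟩-comm : (f g : Fin n → ℚ) → ⟨ f , g ⟩ ≡ ⟨ g , f ⟩
  ⟨⟩-comm f g = Σ-cong (λ i → solve 2 (λ a b → a :* b := b :* a) refl (f i) (g i))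

  module _ (w : Fin n → Fin n → ℚ) (w-sym : ∀ i j → w i j ≡ w j i) where

    Λ-linear : ∀ a (f : Fin n → ℚ) b (g : Fin n → ℚ) i → Λ w (λ j → a * f j + b * g j) i ≡ a * Λ w f i + b * Λ w g i
    Λ-linear a f b g i = trans (cong (a * f i + b * g i +_) (Δ-linear w a f b g i))
      (solve 6 (λ a f b g x y → a :* f :+ b :* g :+ (a :* x :+ b :* y) := a :* (f :+ x) :+ b :* (g :+ y)) refl a (f i) b (g i) (Δ w f i) (Δ w g i))

    Λ-split : (f g : Fin n → ℚ) → ⟨ f , Λ w g ⟩ ≡ ⟨ f , g ⟩ + ⟨ f , Δ w g ⟩
    Λ-split f g = trans (Σ-cong (λ i → solve 3 (λ a b c → a :* (b :+ c) := a :* b :+ a :* c) refl (f i) (g i) (Δ w g i)))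
      (Σ-+ (λ i → f i * g i) (λ i → f i * Δ w g i))

    Λ-selfAdjoint : (f g : Fin n → ℚ) → ⟨ f , Λ w g ⟩ ≡ ⟨ g , Λ w f ⟩
    Λ-selfAdjoint f g = trans (Λ-split f g)
      (trans (cong₂ _+_ (⟨⟩-comm f g) (Δ-selfAdjoint w w-sym g f)) (sym (Λ-split g f)))

    Λ-square : ∀ a (f : Fin n → ℚ) b (g : Fin n → ℚ) → ⟨ (λ i → a * f i + b * g i) , Λ w (λ i → a * f i + b * g i) ⟩
      ≡ a * a * ⟨ f , Λ w f ⟩ + (1ℚ + 1ℚ) * (a * b) * ⟨ f , Λ w g ⟩ + b * b * ⟨ g , Λ w g ⟩
    Λ-square a f b g = begin
      ⟨ y , Λ w y ⟩                                ≡⟨ Σ-cong (λ i → trans (cong (y i *_) (Λ-linear a f b g i)) (solve 2 (λ a b → a :* b := b :* a) refl (y i) (a * Λ w f i + b * Λ w g i))) ⟩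
      ⟨ (λ i → a * Λ w f i + b * Λ w g i) , y ⟩    ≡⟨ ⟨⟩-linearˡ a (Λ w f) b (Λ w g) y ⟩
      a * ⟨ Λ w f , y ⟩ + b * ⟨ Λ w g , y ⟩        ≡⟨ cong₂ (λ p q → a * p + b * q) (half f) (half g) ⟩
      a * (a * ⟨ f , Λ w f ⟩ + b * ⟨ g , Λ w f ⟩) + b * (a * ⟨ f , Λ w g ⟩ + b * ⟨ g , Λ w g ⟩)
        ≡⟨ cong (λ p → a * (a * ⟨ f , Λ w f ⟩ + b * p) + b * (a * ⟨ f , Λ w g ⟩ + b * ⟨ g , Λ w g ⟩)) (Λ-selfAdjoint g f) ⟩
      a * (a * ⟨ f , Λ w f ⟩ + b * ⟨ f , Λ w g ⟩) + b * (a * ⟨ f , Λ w g ⟩ + b * ⟨ g , Λ w g ⟩)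
        ≡⟨ solve 5 (λ a b x y z → a :* (a :* x :+ b :* y) :+ b :* (a :* y :+ b :* z)
             := a :* a :* x :+ (con 1ℚ :+ con 1ℚ) :* (a :* b) :* y :+ b :* b :* z) refl a b ⟨ f , Λ w f ⟩ ⟨ f , Λ w g ⟩ ⟨ g , Λ w g ⟩ ⟩
      a * a * ⟨ f , Λ w f ⟩ + (1ℚ + 1ℚ) * (a * b) * ⟨ f , Λ w g ⟩ + b * b * ⟨ g , Λ w g ⟩ ∎
      where
      open ≡-Reasoning
      y : Fin n → ℚ
      y i = a * f i + b * g i
      half : (h : Fin n → ℚ) → ⟨ Λ w h , y ⟩ ≡ a * ⟨ f , Λ w h ⟩ + b * ⟨ g , Λ w h ⟩
      half h = trans (⟨⟩-comm (Λ w h) y) (⟨⟩-linearˡ a f b g (Λ w h))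

    module _ (0≤w : ∀ i j → 0ℚ ≤ w i j) where

      Λ-nonNegative : ∀ f → 0ℚ ≤ ⟨ f , Λ w f ⟩
      Λ-nonNegative f = subst (0ℚ ≤_) (sym (Λ-split f f))
        (0≤a+b (0≤Σ (λ i → 0≤a*a (f i))) (Δ-nonNegative w w-sym 0≤w f))

      -- Variational lower bound for the diagonal entry q p of the inverse of Λ:
      -- the left-hand side is ⟨ c q − y , Λ (c q − y) ⟩.
      green-variational : ∀ {p} {q : Fin n → ℚ} → (∀ i → Λ w q i ≡ δ p i) → ∀ c (y : Fin n → ℚ) →
        0ℚ ≤ c * c * q p - (1ℚ + 1ℚ) * c * y p + ⟨ y , Λ w y ⟩
      green-variational {p} {q} Λq c y = subst (0ℚ ≤_) eq (Λ-nonNegative (λ i → c * q i + - 1ℚ * y i))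
        where
        ⟨_,Λq⟩ : (f : Fin n → ℚ) → ⟨ f , Λ w q ⟩ ≡ f p
        ⟨ f ,Λq⟩ = trans (Σ-cong (λ i → trans (cong (f i *_) (Λq i)) (solve 2 (λ a b → a :* b := b :* a) refl (f i) (δ p i)))) (Σ-δ p f)
        eq : ⟨ (λ i → c * q i + - 1ℚ * y i) , Λ w (λ i → c * q i + - 1ℚ * y i) ⟩
          ≡ c * c * q p - (1ℚ + 1ℚ) * c * y p + ⟨ y , Λ w y ⟩
        eq = trans (Λ-square c q (- 1ℚ) y)
          (trans (cong₂ (λ a b → c * c * a + (1ℚ + 1ℚ) * (c * - 1ℚ) * b + - 1ℚ * - 1ℚ * ⟨ y , Λ w y ⟩)
                   ⟨ q ,Λq⟩ (trans (Λ-selfAdjoint q y) ⟨ y ,Λq⟩))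
            (solve 4 (λ c a b e → c :* c :* a :+ (con 1ℚ :+ con 1ℚ) :* (c :* con (- 1ℚ)) :* b :+ con (- 1ℚ) :* con (- 1ℚ) :* e
               := c :* c :* a :- (con 1ℚ :+ con 1ℚ) :* c :* b :+ e) refl c (q p) (y p) ⟨ y , Λ w y ⟩))

  argmin : Fin n → (f : Fin n → ℚ) → ∃ λ m → ∀ i → f m ≤ f i
  argmin {suc zero}    _ f = zero , λ { zero → ≤-refl }
  argmin {suc (suc n)} _ f with argmin zero (λ i → f (suc i))
  ... | m , m-min with ≤-total (f zero) (f (suc m))
  ...   | inj₁ p = zero , λ { zero → ≤-refl ; (suc i) → ≤-trans p (m-min i) }
  ...   | inj₂ p = suc m , λ { zero → p ; (suc i) → m-min i }

  -- Serves at a minimum of a superharmonic function, where every term of the Laplacian is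
  -- nonpositive while their sum is not negative; each term must then vanish.
  Σ-nonPos⇒0≤ : {f : Fin n → ℚ} → (∀ i → f i ≤ 0ℚ) → 0ℚ ≤ Σℚ n f → ∀ i → 0ℚ ≤ f i
  Σ-nonPos⇒0≤ {suc n} {f} f≤0 0≤Σf zero =
    subst (0ℚ ≤_) (+-identityʳ (f zero)) (≤-trans 0≤Σf (+-monoʳ-≤ (f zero) (subst (Σℚ n (λ i → f (suc i)) ≤_) (Σ-zero n) (Σ-mono (λ i → f≤0 (suc i))))))
  Σ-nonPos⇒0≤ {suc n} {f} f≤0 0≤Σf (suc i) = Σ-nonPos⇒0≤ (λ i → f≤0 (suc i))
    (subst (0ℚ ≤_) (+-identityˡ (Σℚ n (λ i → f (suc i)))) (≤-trans 0≤Σf (+-monoˡ-≤ (Σℚ n (λ i → f (suc i))) (f≤0 zero)))) i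

  weight : Adj n → Fin n → Fin n → ℚ
  weight adj i j = bit (adj i j)

  0≤weight : (adj : Adj n) → ∀ i j → 0ℚ ≤ weight adj i j
  0≤weight adj i j = 0≤bit (adj i j)

  degree : Adj n → Fin n → ℚ
  degree {n} adj i = Σℚ n (weight adj i)

  volume : Adj n → ℚ
  volume {n} adj = Σℚ n (degree adj)

  module _ {adj : Adj n} {v : Fin n} (walk : ∀ i → Walk adj i v) where

    -- Start at a global minimum and follow a walk to `v`. At a vertex other than `v`,
    -- superharmonicity forces every neighbour to attain the minimum too, so the minimum is carried
    -- along the walk until it is compared with `f v`.
    minimum-principle : ∀ {f} → (∀ i → i ≢ v → 0ℚ ≤ Δ (weight adj) f i) → 0ℚ ≤ f v → ∀ i → 0ℚ ≤ f i
    minimum-principle {f} superharmonic 0≤fv i with argmin v f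
    ... | m , m-min = ≤-trans (along (walk m) m-min) (m-min i)
      where
      along : ∀ {u} → Walk adj u v → (∀ j → f u ≤ f j) → 0ℚ ≤ f u
      along here u-min = 0≤fv
      along (step {u} {x} e rest) u-min with u ≟ v
      ... | yes refl = 0≤fv
      ... | no u≢v   = ≤-trans (along rest (λ j → ≤-trans fx≤fu (u-min j))) fx≤fu
        where
        nonPos : ∀ j → weight adj u j * (f u - f j) ≤ 0ℚ
        nonPos j = 0≤b-a⇒a≤b (subst (0ℚ ≤_)
          (solve 3 (λ w a b → w :* (b :- a) := con 0ℚ :- w :* (a :- b)) refl (weight adj u j) (f u) (f j))
          (0≤a*b (0≤weight adj u j) (0≤b-a (u-min j))))
        fx≤fu : f x ≤ f u
        fx≤fu = 0≤b-a⇒a≤b (subst (0ℚ ≤_)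
          (trans (cong (λ b → bit b * (f u - f x)) e) (*-identityˡ (f u - f x)))
          (Σ-nonPos⇒0≤ nonPos (superharmonic u u≢v) x))

    harmonic⇒zero : ∀ {f} → (∀ i → i ≢ v → Δ (weight adj) f i ≡ 0ℚ) → f v ≡ 0ℚ → ∀ i → f i ≡ 0ℚ
    harmonic⇒zero {f} harmonic fv≡0 i = ≤-antisym
      (0≤b-a⇒a≤b (subst (0ℚ ≤_) (solve 1 (λ a → con (- 1ℚ) :* a :+ con 0ℚ :* a := con 0ℚ :- a) refl (f i))
        -- This is the negative of `f`, put into the two-term shape that `Δ-linear` handles.
        (minimum-principle {λ j → - 1ℚ * f j + 0ℚ * f j}
          (λ j j≢v → ≤-reflexive (sym (trans (Δ-linear (weight adj) (- 1ℚ) f 0ℚ f j) (trans (cong (λ d → - 1ℚ * d + 0ℚ * d) (harmonic j j≢v)) refl))))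
          (≤-reflexive (sym (trans (cong (λ d → - 1ℚ * d + 0ℚ * d) fv≡0) refl))) i)))
      (minimum-principle (λ j j≢v → ≤-reflexive (sym (harmonic j j≢v))) (≤-reflexive (sym fv≡0)) i)

-- Lower bounds for the diagonal of the inverse of Λ.

module Grounded where
  open RationalArithmetic
  open FiniteSums
  open Laplacian
  open import Data.Nat as ℕ using (ℕ)
  open import Data.Fin using (Fin)
  open import Data.Fin.Properties using (_≟_)
  open import Data.Bool using (Bool; true; false)
  open import Data.Rational using (ℚ; 0ℚ; 1ℚ; _+_; _*_; _-_; -_; _≤_; _<_)
  open import Data.Rational.Properties using (+-identityʳ; *-zeroˡ; *-identityʳ; ≤-refl; ≤-reflexive; <-≤-trans; <⇒≤; +-mono-≤)
  open import Data.Rational.Solver using (module +-*-Solver)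
  open +-*-Solver using (solve; _:+_; _:*_; _:-_; :-_; _:=_; con)
  open import Relation.Binary.PropositionalEquality using (_≡_; refl; sym; trans; cong; cong₂; subst; module ≡-Reasoning)
  open import Relation.Nullary using (yes; no)

  -- Degree times effective resistance to the apex of the cone, minus 1. As `1ℚ + degree adj p` is
  -- the diagonal entry of Λ, this measures how far the diagonal of the inverse lies above the
  -- reciprocal of the diagonal; it is 0 at an isolated vertex.
  excess : ∀ {k} → Adj k → (Fin k → Fin k → ℚ) → Fin k → ℚ
  excess adj Q p = (1ℚ + degree adj p) * Q p p - 1ℚ

  module _ {k : ℕ} (adj : Adj k) (simple : IsSimple adj) where
    open IsSimple simple

    private
      w : Fin k → Fin k → ℚ
      w = weight adj

      2ℚ : ℚ
      2ℚ = 1ℚ + 1ℚ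

      h : Fin k → ℚ
      h = degree adj

    weight-sym : ∀ i j → w i j ≡ w j i
    weight-sym i j = cong bit (symmetric i j)

    weight-irrefl : ∀ i → w i i ≡ 0ℚ
    weight-irrefl i = cong bit (irreflexive i)

    weight-idem : ∀ i j → w i j * w i j ≡ w i j
    weight-idem i j = bit*bit (adj i j)

    0≤h : ∀ p → 0ℚ ≤ h p
    0≤h p = 0≤Σ (0≤weight adj p)

    0<1+h : ∀ p → 0ℚ < 1ℚ + h p
    0<1+h p = <-≤-trans (0<ℕ→ℚ {1} (ℕ.s≤s ℕ.z≤n)) (a≤a+b (0≤h p) refl)

    ⟨δ,Λδ⟩ : ∀ p → ⟨ δ p , Λ w (δ p) ⟩ ≡ 1ℚ + h p
    ⟨δ,Λδ⟩ p = trans (Σ-δ p (Λ w (δ p))) (cong₂ _+_ (δ-refl p) (Σ-cong off))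
      where
      off : ∀ j → w p j * (δ p p - δ p j) ≡ w p j
      off j with p ≟ j
      ... | yes refl = trans (cong (_* (δ p p - 1ℚ)) (weight-irrefl p)) (trans (*-zeroˡ (δ p p - 1ℚ)) (sym (weight-irrefl p)))
      ... | no _     = trans (cong (λ e → w p j * (e - 0ℚ)) (δ-refl p)) (*-identityʳ (w p j))

    -- Summing over all vertices kills the Laplacian part of Λ.
    Σx≡Σh : ∀ {x : Fin k → ℚ} → (∀ i → Λ w x i ≡ h i) → Σℚ k x ≡ Σℚ k h
    Σx≡Σh {x} Λx = begin
      Σℚ k x                      ≡⟨ +-identityʳ (Σℚ k x) ⟨
      Σℚ k x + 0ℚ                 ≡⟨ cong (Σℚ k x +_) (Σ-Δ w weight-sym x) ⟨
      Σℚ k x + Σℚ k (Δ w x)       ≡⟨ Σ-+ x (Δ w x) ⟨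
      Σℚ k (Λ w x)                ≡⟨ Σ-cong Λx ⟩
      Σℚ k h                      ∎
      where open ≡-Reasoning

    module _ (Q : Fin k → Fin k → ℚ) (ΛQ : ∀ p i → Λ w (Q p) i ≡ δ p i) where

      module _ (x : Fin k → ℚ) (Λx : ∀ i → Λ w x i ≡ h i) where

        -- The test vector is N δ_p + (1 + h p) x.
        vertex-energy-bound : ∀ N p →
          0ℚ ≤ N * N * excess adj Q p + (2ℚ * N * h p - 2ℚ * N * ((1ℚ + h p) * x p) + (1ℚ + h p) * ⟨ h , x ⟩)
        vertex-energy-bound N p = 0≤a*b⇒0≤b (0<1+h p) (subst (0ℚ ≤_) eq
          (green-variational w weight-sym (0≤weight adj) {q = Q p} (ΛQ p) (d * N) y))
          where
          d = 1ℚ + h p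
          t = ⟨ h , x ⟩
          y : Fin k → ℚ
          y i = N * δ p i + d * x i
          energy : ⟨ y , Λ w y ⟩ ≡ N * N * d + 2ℚ * (N * d) * h p + d * d * t
          energy = trans (Λ-square w weight-sym N (δ p) d x)
            (cong₂ _+_ (cong₂ (λ a b → N * N * a + 2ℚ * (N * d) * b) (⟨δ,Λδ⟩ p) (trans (Σ-δ p (Λ w x)) (Λx p)))
              (cong (d * d *_) (trans (Σ-cong (λ i → cong (x i *_) (Λx i))) (⟨⟩-comm x h))))
          eq : d * N * (d * N) * Q p p - 2ℚ * (d * N) * y p + ⟨ y , Λ w y ⟩
             ≡ d * (N * N * excess adj Q p + (2ℚ * N * h p - 2ℚ * N * (d * x p) + d * t))
          eq = trans (cong₂ (λ e f → d * N * (d * N) * Q p p - 2ℚ * (d * N) * (N * e + d * x p) + f) (δ-refl p) energy)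
            (solve 5 (λ N h q x t → let d = con 1ℚ :+ h in
               d :* N :* (d :* N) :* q :- (con 1ℚ :+ con 1ℚ) :* (d :* N) :* (N :* con 1ℚ :+ d :* x)
                 :+ (N :* N :* d :+ (con 1ℚ :+ con 1ℚ) :* (N :* d) :* h :+ d :* d :* t)
               := d :* (N :* N :* (d :* q :- con 1ℚ) :+ ((con 1ℚ :+ con 1ℚ) :* N :* h :- (con 1ℚ :+ con 1ℚ) :* N :* (d :* x) :+ d :* t)))
              refl N (h p) (Q p p) (x p) t)

        -- For arbitrary `N`, the vertex bounds add up to 0 ≤ N² s - 2 N t + (k + Σ h) t, because
        -- the two terms in Σ h and Σ x cancel. The choice N = k + Σ h maximises the resulting lower
        -- bound (2 N - k - Σ h) t / N² for s.
        energy-bound : 1 ℕ.≤ k → ⟨ h , x ⟩ ≤ (ℕ→ℚ k + Σℚ k h) * Σℚ k (excess adj Q)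
        energy-bound 1≤k = 0≤b-a⇒a≤b (0≤a*b⇒0≤b 0<N (subst (0ℚ ≤_) eq (0≤Σ (vertex-energy-bound N))))
          where
          open ≡-Reasoning
          N = ℕ→ℚ k + Σℚ k h
          t = ⟨ h , x ⟩
          s = Σℚ k (excess adj Q)
          0<N : 0ℚ < N
          0<N = <-≤-trans (0<ℕ→ℚ 1≤k) (a≤a+b (0≤Σ 0≤h) refl)
          eq : Σℚ k (λ p → N * N * excess adj Q p + (2ℚ * N * h p - 2ℚ * N * ((1ℚ + h p) * x p) + (1ℚ + h p) * t)) ≡ N * (N * s - t)
          eq = begin
            Σℚ k (λ p → N * N * excess adj Q p + (2ℚ * N * h p - 2ℚ * N * ((1ℚ + h p) * x p) + (1ℚ + h p) * t))
              ≡⟨ Σ-cong (λ p → solve 5 (λ N e h x t → N :* N :* e :+ ((con 1ℚ :+ con 1ℚ) :* N :* h :- (con 1ℚ :+ con 1ℚ) :* N :* ((con 1ℚ :+ h) :* x) :+ (con 1ℚ :+ h) :* t)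
                   := N :* N :* e :+ (((con 1ℚ :+ con 1ℚ) :* N :+ t) :* h :+ (:- ((con 1ℚ :+ con 1ℚ) :* N) :* x :+ (:- ((con 1ℚ :+ con 1ℚ) :* N) :* (h :* x) :+ t))))
                   refl N (excess adj Q p) (h p) (x p) t) ⟩
            Σℚ k (λ p → N * N * excess adj Q p + ((2ℚ * N + t) * h p + (- (2ℚ * N) * x p + (- (2ℚ * N) * (h p * x p) + t))))
              ≡⟨ trans (Σ-*+ (N * N) (excess adj Q) (λ p → (2ℚ * N + t) * h p + (- (2ℚ * N) * x p + (- (2ℚ * N) * (h p * x p) + t)))) (cong (N * N * s +_)
                (trans (Σ-*+ (2ℚ * N + t) h (λ p → - (2ℚ * N) * x p + (- (2ℚ * N) * (h p * x p) + t))) (cong ((2ℚ * N + t) * Σℚ k h +_)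
                (trans (Σ-*+ (- (2ℚ * N)) x (λ p → - (2ℚ * N) * (h p * x p) + t)) (cong₂ (λ a b → - (2ℚ * N) * a + b) (Σx≡Σh Λx)
                (trans (Σ-*+ (- (2ℚ * N)) (λ p → h p * x p) (λ _ → t)) (cong (- (2ℚ * N) * t +_) (Σ-const k t)))))))) ⟩
            N * N * s + ((2ℚ * N + t) * Σℚ k h + (- (2ℚ * N) * Σℚ k h + (- (2ℚ * N) * t + ℕ→ℚ k * t)))
              ≡⟨ solve 4 (λ κ η s t → let N = κ :+ η in
                   N :* N :* s :+ (((con 1ℚ :+ con 1ℚ) :* N :+ t) :* η :+ (:- ((con 1ℚ :+ con 1ℚ) :* N) :* η :+ (:- ((con 1ℚ :+ con 1ℚ) :* N) :* t :+ κ :* t)))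
                   := N :* (N :* s :- t)) refl (ℕ→ℚ k) (Σℚ k h) s t ⟩
            N * (N * s - t) ∎

      module _ (C : Fin k → Bool) (closed : ∀ i j → adj i j ≡ true → C i ≡ C j) where

        private
          χ : Fin k → ℚ
          χ i = bit (C i)

        size : ℚ
        size = Σℚ k χ

        private
          -- A closed set is a union of components, so its indicator lies in the kernel of the
          -- Laplacian.
          Λχ : ∀ i → Λ w χ i ≡ χ i
          Λχ i = trans (cong (χ i +_) (trans (Σ-cong flat) (Σ-zero k))) (+-identityʳ (χ i))
            where
            flat : ∀ j → w i j * (χ i - χ j) ≡ 0ℚ
            flat j with adj i j in e
            ... | false = *-zeroˡ (χ i - χ j)
            ... | true rewrite closed i j e = solve 1 (λ a → con 1ℚ :* (a :- a) := con 0ℚ) refl (χ j)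

          ⟨f,Λχ⟩ : (f : Fin k → ℚ) → ⟨ f , Λ w χ ⟩ ≡ ⟨ f , χ ⟩
          ⟨f,Λχ⟩ f = Σ-cong (λ i → cong (f i *_) (Λχ i))

          χχ : ∀ i → χ i * χ i ≡ χ i
          χχ i = bit*bit (C i)

        module _ (p : Fin k) (p∈C : C p ≡ true) where

          private
            g : Fin k → ℚ
            g = w p

            χp≡1 : χ p ≡ 1ℚ
            χp≡1 = cong bit p∈C

            gχ : ∀ j → g j * χ j ≡ g j
            gχ j with adj p j in e
            ... | false = *-zeroˡ (χ j)
            ... | true rewrite sym (closed p j e) | p∈C = refl

            ⟨g,χ⟩ : ⟨ g , χ ⟩ ≡ h p
            ⟨g,χ⟩ = Σ-cong gχ

            ⟨χ,Λg⟩ : ⟨ χ , Λ w g ⟩ ≡ h p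
            ⟨χ,Λg⟩ = trans (Λ-selfAdjoint w weight-sym χ g) (trans (⟨f,Λχ⟩ g) ⟨g,χ⟩)

            ⟨χ,Λδ⟩ : ⟨ χ , Λ w (δ p) ⟩ ≡ 1ℚ
            ⟨χ,Λδ⟩ = trans (Λ-selfAdjoint w weight-sym χ (δ p)) (trans (⟨f,Λχ⟩ (δ p)) (trans (Σ-δ p χ) χp≡1))

            ⟨χ,Λχ⟩ : ⟨ χ , Λ w χ ⟩ ≡ size
            ⟨χ,Λχ⟩ = trans (⟨f,Λχ⟩ χ) (Σ-cong χχ)

            ⟨g,Λδ⟩ : ⟨ g , Λ w (δ p) ⟩ ≡ - h p
            ⟨g,Λδ⟩ = trans (Λ-selfAdjoint w weight-sym g (δ p)) (trans (Σ-δ p (Λ w g))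
              (trans (cong₂ _+_ (weight-irrefl p) (Σ-cong (λ j → trans (cong (λ e → w p j * (e - w p j)) (weight-irrefl p))
                  (trans (solve 1 (λ a → a :* (con 0ℚ :- a) := con (- 1ℚ) :* (a :* a)) refl (w p j)) (cong (- 1ℚ *_) (weight-idem p j))))))
              (trans (cong (0ℚ +_) (Σ-* (- 1ℚ) (w p)))
                (solve 1 (λ a → con 0ℚ :+ con (- 1ℚ) :* a := :- a) refl (h p)))))

            -- ⟨ g , Δ g ⟩ counts the edges leaving the neighbourhood of p, each of which ends in C.
            ⟨g,Λg⟩≤ : ⟨ g , Λ w g ⟩ ≤ h p + h p * (size - h p)
            ⟨g,Λg⟩≤ = subst (_≤ h p + h p * (size - h p)) (sym (Λ-split w weight-sym g g))
              (+-mono-≤ (≤-reflexive (Σ-cong (weight-idem p)))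
                (subst (⟨ g , Δ w g ⟩ ≤_) total (Σ-mono row)))
              where
              leaving : ∀ i j → g i * (w i j * (g i - g j)) ≤ g i * (χ j - g j)
              leaving i j with adj p i in ei | adj i j in eij | adj p j in ej
              ... | false | b     | c     = ≤-reflexive (trans (*-zeroˡ (bit b * (0ℚ - bit c))) (sym (*-zeroˡ (χ j - bit c))))
              ... | true  | true  | true  rewrite sym (closed p j ej) | p∈C = ≤-refl
              ... | true  | false | true  rewrite sym (closed p j ej) | p∈C = ≤-refl
              ... | true  | true  | false rewrite sym (closed i j eij) | sym (closed p i ei) | p∈C = ≤-refl
              ... | true  | false | false with C j
              ...   | true  = 0≤1
              ...   | false = ≤-refl
              row : ∀ i → g i * Δ w g i ≤ g i * (size - h p)
              row i = subst (_≤ g i * (size - h p)) (Σ-* (g i) (λ j → w i j * (g i - g j)))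
                (subst (Σℚ k (λ j → g i * (w i j * (g i - g j))) ≤_)
                  (trans (Σ-* (g i) (λ j → χ j - g j)) (cong (g i *_) (Σ-- χ g)))
                  (Σ-mono (leaving i)))
              total : Σℚ k (λ i → g i * (size - h p)) ≡ h p * (size - h p)
              total = trans (Σ-cong (λ i → solve 2 (λ a b → a :* b := b :* a) refl (g i) (size - h p)))
                (trans (Σ-* (size - h p) g) (solve 2 (λ a b → a :* b := b :* a) refl (size - h p) (h p)))

          -- The test vector is h p on C, plus the indicator of the neighbours of p, plus (μ + 1) δ_p;
          -- it is optimal when C is complete, and also when C is a star.
          excess-bound : ∀ μ → 0ℚ ≤ μ → size ≤ μ → h p ≤ (μ + 1ℚ) * excess adj Q p
          excess-bound μ 0≤μ size≤μ = 0≤b-a⇒a≤b (0≤a*b⇒0≤b 0<c (subst (0ℚ ≤_) eq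
              (0≤a+b (green-variational w weight-sym (0≤weight adj) {q = Q p} (ΛQ p) c y)
                (0≤a+b (0≤b-a ⟨g,Λg⟩≤) (0≤a*b (0≤a*b (0≤h p) (<⇒≤ (0<1+h p))) (0≤b-a size≤μ))))))
            where
            H = h p
            c = (μ + 1ℚ) * (1ℚ + H)
            G = ⟨ g , Λ w g ⟩
            y₀ y : Fin k → ℚ
            y₀ i = H * χ i + 1ℚ * g i
            y i = 1ℚ * y₀ i + (μ + 1ℚ) * δ p i
            0<μ+1 : 0ℚ < μ + 1ℚ
            0<μ+1 = <-≤-trans (0<ℕ→ℚ {1} (ℕ.s≤s ℕ.z≤n)) (a≤a+b 0≤μ (solve 1 (λ a → con 1ℚ :+ a := a :+ con 1ℚ) refl μ))
            0<c : 0ℚ < c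
            0<c = 0<a*b 0<μ+1 (0<1+h p)
            energy₀ : ⟨ y₀ , Λ w y₀ ⟩ ≡ H * H * size + 2ℚ * (H * 1ℚ) * H + 1ℚ * 1ℚ * G
            energy₀ = trans (Λ-square w weight-sym H χ 1ℚ g)
              (cong₂ (λ a b → H * H * a + 2ℚ * (H * 1ℚ) * b + 1ℚ * 1ℚ * G) ⟨χ,Λχ⟩ ⟨χ,Λg⟩)
            -- The value is 0: the coefficient `H` of `χ` is chosen to make `y₀` orthogonal to `δ p`
            -- for the energy form. Thus `y₀` adds a gain of `H * H` over its own energy to the
            -- value 1 / (1 + H) that `δ p` gives.
            cross : ⟨ y₀ , Λ w (δ p) ⟩ ≡ H * 1ℚ + 1ℚ * (- H)
            cross = trans (⟨⟩-linearˡ H χ 1ℚ g (Λ w (δ p))) (cong₂ (λ a b → H * a + 1ℚ * b) ⟨χ,Λδ⟩ ⟨g,Λδ⟩)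
            energy : ⟨ y , Λ w y ⟩ ≡ 1ℚ * 1ℚ * (H * H * size + 2ℚ * (H * 1ℚ) * H + 1ℚ * 1ℚ * G)
              + 2ℚ * (1ℚ * (μ + 1ℚ)) * (H * 1ℚ + 1ℚ * (- H)) + (μ + 1ℚ) * (μ + 1ℚ) * (1ℚ + H)
            energy = trans (Λ-square w weight-sym 1ℚ y₀ (μ + 1ℚ) (δ p))
              (cong₂ _+_ (cong₂ (λ a b → 1ℚ * 1ℚ * a + 2ℚ * (1ℚ * (μ + 1ℚ)) * b) energy₀ cross)
                 (cong ((μ + 1ℚ) * (μ + 1ℚ) *_) (⟨δ,Λδ⟩ p)))
            yp : y p ≡ H + (μ + 1ℚ)
            yp = trans (cong₂ _+_ (cong₂ (λ a b → 1ℚ * (H * a + 1ℚ * b)) χp≡1 (weight-irrefl p)) (cong ((μ + 1ℚ) *_) (δ-refl p)))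
              (solve 2 (λ H m → con 1ℚ :* (H :* con 1ℚ :+ con 1ℚ :* con 0ℚ) :+ m :* con 1ℚ := H :+ m) refl H (μ + 1ℚ))
            -- With the bound on `G`, the energy of `y₀` is at most H (1 + H) (size + 1), which
            -- explains the factor `μ + 1ℚ`. The `size` occurs as `H * H * size` in that energy and
            -- as `H * size` in the bound on `G`, so replacing it by `μ` costs
            -- `H * (1ℚ + H) * (μ - size)`.
            eq : c * c * Q p p - 2ℚ * c * y p + ⟨ y , Λ w y ⟩ + ((H + H * (size - H) - G) + H * (1ℚ + H) * (μ - size))
               ≡ c * ((μ + 1ℚ) * excess adj Q p - H)
            eq = trans (cong₂ (λ a b → c * c * Q p p - 2ℚ * c * a + b + ((H + H * (size - H) - G) + H * (1ℚ + H) * (μ - size))) yp energy)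
              (solve 5 (λ μ H q G S → let c = (μ :+ con 1ℚ) :* (con 1ℚ :+ H) ; two = con 1ℚ :+ con 1ℚ ; m = μ :+ con 1ℚ in
                c :* c :* q :- two :* c :* (H :+ m) :+ (con 1ℚ :* con 1ℚ :* (H :* H :* S :+ two :* (H :* con 1ℚ) :* H :+ con 1ℚ :* con 1ℚ :* G)
                  :+ two :* (con 1ℚ :* m) :* (H :* con 1ℚ :+ con 1ℚ :* (:- H)) :+ m :* m :* (con 1ℚ :+ H))
                  :+ ((H :+ H :* (S :- H) :- G) :+ H :* (con 1ℚ :+ H) :* (μ :- S))
                := c :* (m :* ((con 1ℚ :+ H) :* q :- con 1ℚ) :- H)) refl μ H (Q p p) G size)

-- Hitting times as potentials, and Kemeny's constant seen from one vertex.

module HittingTimes where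
  open RationalArithmetic
  open FiniteSums
  open Laplacian
  open import Data.Nat as ℕ using (ℕ; zero; suc)
  import Data.Nat.Properties as ℕ
  open import Data.Fin using (Fin; zero; suc; toℕ)
  open import Data.Fin.Properties using (_≟_; toℕ-injective)
  open import Data.Bool using (Bool; true; false; _∧_; T)
  open import Data.Product using (proj₁; proj₂)
  open import Data.Rational using (ℚ; 0ℚ; 1ℚ; _+_; _*_; _-_; -_; _≤_; _<_)
  open import Data.Rational.Properties using (+-identityˡ; +-identityʳ; *-zeroˡ; *-identityˡ; <-irrefl; +-inverseʳ)
  open import Data.Rational.Solver using (module +-*-Solver)
  open +-*-Solver using (solve; _:+_; _:*_; _:-_; :-_; _:=_; con)
  open import Relation.Binary.PropositionalEquality using (_≡_; _≢_; refl; sym; trans; cong; cong₂; subst; module ≡-Reasoning)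
  open import Relation.Nullary using (yes; no; does)
  open import Relation.Nullary.Decidable using (dec-true)
  open import Data.Empty using (⊥-elim)
  open Grounded using (weight-sym)

  module _ {n : ℕ} (adj : Adj n) (simple : IsSimple adj) where
    open IsSimple simple

    private
      w : Fin n → Fin n → ℚ
      w = weight adj

    deg≡degree : ∀ i → ℕ→ℚ (deg adj i) ≡ degree adj i
    deg≡degree i = trans (Σ-ℕ→ℚ (λ j → b2ℕ (adj i j))) (Σ-cong (λ j → ℕ→ℚ-b2ℕ (adj i j)))

    handshake : ℕ→ℚ (edges adj) + ℕ→ℚ (edges adj) ≡ volume adj
    handshake = begin
      ℕ→ℚ (edges adj) + ℕ→ℚ (edges adj)
        ≡⟨ cong₂ _+_ E (trans E (Σ-swap e)) ⟩
      Σℚ n (λ i → Σℚ n (e i)) + Σℚ n (λ i → Σℚ n (λ j → e j i))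
        ≡⟨ Σ-+ (λ i → Σℚ n (e i)) (λ i → Σℚ n (λ j → e j i)) ⟨
      Σℚ n (λ i → Σℚ n (e i) + Σℚ n (λ j → e j i))
        ≡⟨ Σ-cong (λ i → trans (sym (Σ-+ (e i) (λ j → e j i))) (Σ-cong (orient i))) ⟩
      volume adj ∎
      where
      open ≡-Reasoning
      infix 8 _<?_
      _<?_ : Fin n → Fin n → Bool
      i <? j = does (toℕ i ℕ.<? toℕ j)
      e : Fin n → Fin n → ℚ
      e i j = bit (adj i j ∧ i <? j)
      E : ℕ→ℚ (edges adj) ≡ Σℚ n (λ i → Σℚ n (e i))
      E = trans (Σ-ℕ→ℚ (λ i → Σℕ n (λ j → b2ℕ (adj i j ∧ i <? j))))
        (Σ-cong (λ i → trans (Σ-ℕ→ℚ (λ j → b2ℕ (adj i j ∧ i <? j))) (Σ-cong (λ j → ℕ→ℚ-b2ℕ (adj i j ∧ i <? j)))))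
      -- Here `b` and `c` stand for the two orientations of a pair; the hypotheses say that they can
      -- agree only where `a` is false.
      ∧-split : ∀ a b c → (b ≡ true → c ≡ true → a ≡ false) → (b ≡ false → c ≡ false → a ≡ false) →
        bit (a ∧ b) + bit (a ∧ c) ≡ bit a
      ∧-split false b     c     f g = refl
      ∧-split true  true  true  f g with () ← f refl refl
      ∧-split true  true  false f g = refl
      ∧-split true  false true  f g = refl
      ∧-split true  false false f g with () ← g refl refl
      <?-true : ∀ i j → i <? j ≡ true → toℕ i ℕ.< toℕ j
      <?-true i j p = ℕ.<ᵇ⇒< (toℕ i) (toℕ j) (subst T (sym p) _)
      <?-false : ∀ i j → i <? j ≡ false → toℕ j ℕ.≤ toℕ i
      <?-false i j p = ℕ.≮⇒≥ (λ i<j → true≢false (trans (sym (dec-true (toℕ i ℕ.<? toℕ j) i<j)) p))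
        where
        true≢false : true ≢ false
        true≢false ()
      orient : ∀ i j → e i j + e j i ≡ w i j
      orient i j = trans (cong (λ b → bit (adj i j ∧ i <? j) + bit (b ∧ j <? i)) (symmetric j i))
        (∧-split (adj i j) (i <? j) (j <? i)
          (λ p q → ⊥-elim (ℕ.<-asym (<?-true i j p) (<?-true j i q)))
          (λ p q → loop (toℕ-injective (ℕ.≤-antisym (<?-false j i q) (<?-false i j p)))))
        where
        loop : ∀ {i j} → i ≡ j → adj i j ≡ false
        loop {i} refl = irreflexive i

    module _ {M : Fin n → Fin n → ℚ} (hitting : IsHittingTimes adj M) where

      M-diagonal : ∀ j → M j j ≡ 0ℚ
      M-diagonal = proj₁ hitting

      private
        to : Fin n → Fin n → ℚ
        to j i = M i j

        Δ-off : ∀ i j → i ≢ j → Δ w (to j) i ≡ degree adj i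
        Δ-off i j i≢j = begin
          Δ w (to j) i                                                    ≡⟨ Δ-expand w (to j) i ⟩
          degree adj i * M i j - Σℚ n (λ k → w i k * M k j)                   ≡⟨ cong (_- Σℚ n (λ k → w i k * M k j)) (trans (cong (_* M i j) (sym (deg≡degree i))) (trans (proj₂ hitting i j i≢j) (cong₂ _+_ (deg≡degree i) (Σ-cong (λ k → cong (_* M k j) (ℕ→ℚ-b2ℕ (adj i k))))))) ⟩
          degree adj i + Σℚ n (λ k → w i k * M k j) - Σℚ n (λ k → w i k * M k j) ≡⟨ solve 2 (λ a b → a :+ b :- b := a) refl (degree adj i) (Σℚ n (λ k → w i k * M k j)) ⟩
          degree adj i ∎
          where open ≡-Reasoning

      -- The value on the diagonal is forced by Σ-Δ.
      Δ-hitting : ∀ j i → Δ w (λ u → M u j) i ≡ degree adj i - volume adj * δ j i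
      Δ-hitting j i with j ≟ i
      ... | no j≢i = trans (Δ-off i j (λ e → j≢i (sym e)))
        (solve 2 (λ a b → a := a :- b :* con 0ℚ) refl (degree adj i) (volume adj))
      ... | yes refl = begin
          Δ w (to j) j                                  ≡⟨ solve 2 (λ a b → a := b :+ (a :- b)) refl (Δ w (to j) j) (degree adj j) ⟩
          degree adj j + residue j                          ≡⟨ cong (degree adj j +_) (Σ-δ j residue) ⟨
          degree adj j + Σℚ n (λ i → δ j i * residue i)     ≡⟨ cong (degree adj j +_) (Σ-cong supported) ⟩
          degree adj j + Σℚ n residue                       ≡⟨ cong (degree adj j +_) (trans (Σ-- (Δ w (to j)) (degree adj)) (cong (_- volume adj) (Σ-Δ w (weight-sym adj simple) (to j)))) ⟩
          degree adj j + (0ℚ - volume adj)                      ≡⟨ solve 2 (λ a b → a :+ (con 0ℚ :- b) := a :- b :* con 1ℚ) refl (degree adj j) (volume adj) ⟩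
          degree adj j - volume adj * 1ℚ                        ∎
          where
          open ≡-Reasoning
          residue : Fin n → ℚ
          residue i = Δ w (to j) i - degree adj i
          supported : ∀ i → δ j i * residue i ≡ residue i
          supported i with j ≟ i
          ... | yes _  = *-identityˡ (residue i)
          ... | no j≢i = trans (*-zeroˡ (residue i)) (sym (trans (cong (_- degree adj i) (Δ-off i j (λ e → j≢i (sym e)))) (+-inverseʳ (degree adj i))))

      -- The total degree times the potential of a unit current from j to v, normalised to vanish at v.
      potential : Fin n → Fin n → Fin n → ℚ
      potential v j u = M u v - M u j + M v j

      potential-v : ∀ v j → potential v j v ≡ 0ℚ
      potential-v v j = trans (cong (λ e → e - M v j + M v j) (M-diagonal v))
        (solve 1 (λ a → con 0ℚ :- a :+ a := con 0ℚ) refl (M v j))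

      -- The commute time identity: `potential v j j` is the total degree times the effective
      -- resistance between `v` and `j`, and it unfolds to the sum of the two hitting times.
      M≡potential : ∀ v j → M v j ≡ potential v j j - M j v
      M≡potential v j = trans (solve 2 (λ a b → a := b :- con 0ℚ :+ a :- b) refl (M v j) (M j v))
        (cong (λ e → M j v - e + M v j - M j v) (sym (M-diagonal j)))

      -- The hitting times of `v` and of `j` have the same degree term in their Laplacian.
      -- Subtracting them leaves only the two point masses.
      Δ-potential : ∀ v j u → Δ w (potential v j) u ≡ volume adj * (δ j u - δ v u)
      Δ-potential v j u = begin
        Δ w (potential v j) u
          ≡⟨ Σ-cong (λ i → solve 6 (λ w a b c d e → w :* (a :- b :+ e :- (c :- d :+ e)) := w :* (a :- c) :- w :* (b :- d)) refl (w u i) (M u v) (M u j) (M i v) (M i j) (M v j)) ⟩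
        Σℚ n (λ i → w u i * (M u v - M i v) - w u i * (M u j - M i j))
          ≡⟨ Σ-- (λ i → w u i * (M u v - M i v)) (λ i → w u i * (M u j - M i j)) ⟩
        Δ w (to v) u - Δ w (to j) u
          ≡⟨ cong₂ _-_ (Δ-hitting v u) (Δ-hitting j u) ⟩
        (degree adj u - volume adj * δ v u) - (degree adj u - volume adj * δ j u)
          ≡⟨ solve 4 (λ d V a b → (d :- V :* a) :- (d :- V :* b) := V :* (b :- a)) refl (degree adj u) (volume adj) (δ v u) (δ j u) ⟩
        volume adj * (δ j u - δ v u) ∎
        where open ≡-Reasoning

      private
        F : Fin n → ℚ
        F i = Σℚ n (λ j → degree adj j * M i j)

        -- The reason why Kemeny's constant does not depend on the start: weighting `Δ-hitting` by
        -- the degrees of the targets, the uniform part adds up to `degree adj i * volume adj`,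
        -- which is exactly what the point mass at `i` removes.
        F-harmonic : ∀ i → Δ w F i ≡ 0ℚ
        F-harmonic i = begin
          Σℚ n (λ u → w i u * (F i - F u))
            ≡⟨ Σ-cong (λ u → trans (cong (w i u *_) (trans (sym (Σ-- (λ j → degree adj j * M i j) (λ j → degree adj j * M u j))) refl)) (sym (Σ-* (w i u) (λ j → degree adj j * M i j - degree adj j * M u j)))) ⟩
          Σℚ n (λ u → Σℚ n (λ j → w i u * (degree adj j * M i j - degree adj j * M u j)))
            ≡⟨ Σ-swap (λ u j → w i u * (degree adj j * M i j - degree adj j * M u j)) ⟩
          Σℚ n (λ j → Σℚ n (λ u → w i u * (degree adj j * M i j - degree adj j * M u j)))
            ≡⟨ Σ-cong (λ j → trans (Σ-cong (λ u → solve 4 (λ w d a b → w :* (d :* a :- d :* b) := d :* (w :* (a :- b))) refl (w i u) (degree adj j) (M i j) (M u j))) (Σ-* (degree adj j) (λ u → w i u * (M i j - M u j)))) ⟩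
          Σℚ n (λ j → degree adj j * Δ w (to j) i)
            ≡⟨ Σ-cong (λ j → trans (cong (degree adj j *_) (trans (Δ-hitting j i) (cong (λ e → degree adj i - volume adj * e) (δ-sym j i))))
                 (solve 4 (λ dj di V e → dj :* (di :- V :* e) := di :* dj :+ (:- V) :* (e :* dj)) refl (degree adj j) (degree adj i) (volume adj) (δ i j))) ⟩
          Σℚ n (λ j → degree adj i * degree adj j + (- volume adj) * (δ i j * degree adj j))
            ≡⟨ trans (Σ-*+ (degree adj i) (degree adj) (λ j → (- volume adj) * (δ i j * degree adj j))) (cong (degree adj i * volume adj +_) (trans (Σ-* (- volume adj) (λ j → δ i j * degree adj j)) (cong (- volume adj *_) (Σ-δ i (degree adj))))) ⟩
          degree adj i * volume adj + (- volume adj) * degree adj i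
            ≡⟨ solve 2 (λ d V → d :* V :+ (:- V) :* d := con 0ℚ) refl (degree adj i) (volume adj) ⟩
          0ℚ ∎
          where open ≡-Reasoning

      -- A function harmonic everywhere on a connected graph is constant, so the given start `i` may
      -- be exchanged for the attachment vertex.
      kemeny-formula : ∀ {v} → (∀ i → Walk adj i v) → 0ℚ < volume adj → ∀ i →
        volume adj * kemenyFrom adj M i ≡ Σℚ n (λ j → degree adj j * M v j)
      kemeny-formula {v} walk 0<vol i = trans (trans scaled (solve 2 (λ a b → a := (a :- b) :+ b) refl (F i) (F v)))
        (trans (cong (_+ F v) (harmonic⇒zero walk {λ u → F u - F v} (λ u _ → trans (Σ-cong (λ x → solve 4 (λ w a b c → w :* (a :- c :- (b :- c)) := w :* (a :- b)) refl (w u x) (F u) (F x) (F v))) (F-harmonic u)) (+-inverseʳ (F v)) i))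
          (+-identityˡ (F v)))
        where
        open ≡-Reasoning
        ι = inv (2 ℕ.* edges adj)
        vol : volume adj ≡ ℕ→ℚ (2 ℕ.* edges adj)
        vol = trans (sym handshake) (trans (sym (ℕ→ℚ-homo-+ (edges adj) (edges adj))) (cong (λ x → ℕ→ℚ (edges adj ℕ.+ x)) (sym (ℕ.+-identityʳ (edges adj)))))
        1≤ : ∀ a → 0ℚ < ℕ→ℚ a → 1 ℕ.≤ a
        1≤ zero    p = ⊥-elim (<-irrefl refl p)
        1≤ (suc a) _ = ℕ.s≤s ℕ.z≤n
        -- A positive volume means that there is an edge, so `inv` is a true reciprocal here and not
        -- its default value 0.
        vol*ι : volume adj * ι ≡ 1ℚ
        vol*ι = trans (cong (_* ι) vol) (inv-inverseʳ (1≤ (2 ℕ.* edges adj) (subst (0ℚ <_) vol 0<vol)))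
        scaled : volume adj * kemenyFrom adj M i ≡ F i
        scaled = begin
          volume adj * kemenyFrom adj M i
            ≡⟨ cong (volume adj *_) (trans (Σ-cong (λ j → trans (cong (λ d → d * ι * M i j) (deg≡degree j)) (solve 3 (λ d c m → d :* c :* m := c :* (d :* m)) refl (degree adj j) ι (M i j)))) (Σ-* ι (λ j → degree adj j * M i j))) ⟩
          volume adj * (ι * F i)   ≡⟨ solve 3 (λ a b c → a :* (b :* c) := (a :* b) :* c) refl (volume adj) ι (F i) ⟩
          volume adj * ι * F i     ≡⟨ cong (_* F i) vol*ι ⟩
          1ℚ * F i             ≡⟨ *-identityˡ (F i) ⟩
          F i ∎

-- Kemeny's constant of a graph with a cone attached at a vertex.

module Attachment where
  open FiniteSums
  open Laplacian
  open HittingTimes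
  open import Data.Nat as ℕ using (ℕ)
  open import Data.Fin using (Fin; _↑ˡ_; _↑ʳ_; splitAt)
  open import Data.Fin.Properties using (_≟_; splitAt⁻¹-↑ˡ; splitAt⁻¹-↑ʳ; splitAt-↑ˡ; splitAt-↑ʳ; ↑ˡ-injective; ↑ʳ-injective)
  open import Data.Sum using (inj₁; inj₂)
  open import Data.Rational using (ℚ; 0ℚ; 1ℚ; _+_; _*_; _-_; -_; 1/_; _<_; positive)
  open import Data.Rational.Properties using (+-identityʳ; *-zeroʳ; *-zeroˡ; *-identityˡ; *-identityʳ; *-inverseʳ; pos⇒nonZero)
  open import Data.Rational.Solver using (module +-*-Solver)
  open +-*-Solver using (solve; _:+_; _:*_; _:-_; :-_; _:=_; con)
  open import Relation.Binary.PropositionalEquality using (_≡_; _≢_; refl; sym; trans; cong; cong₂; subst; module ≡-Reasoning)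
  open import Relation.Nullary using (yes; no; does)
  open import Relation.Nullary.Decidable using (dec-true)
  open import Data.Empty using (⊥-elim)

  -- The four blocks of the adjacency matrix. Both graphs to be compared are instances, with `H`
  -- empty before the addition and `H` the graph of the added pairs after it, so one decomposition
  -- serves for both.
  record Attached {n k : ℕ} (adj : Adj n) (v : Fin n) (H : Adj k) (G : Adj (n ℕ.+ k)) : Set where
    field
      ↑ˡ↑ˡ : ∀ i j → G (i ↑ˡ k) (j ↑ˡ k) ≡ adj i j
      ↑ˡ↑ʳ : ∀ i q → G (i ↑ˡ k) (n ↑ʳ q) ≡ does (i ≟ v)
      ↑ʳ↑ˡ : ∀ p j → G (n ↑ʳ p) (j ↑ˡ k) ≡ does (j ≟ v)
      ↑ʳ↑ʳ : ∀ p q → G (n ↑ʳ p) (n ↑ʳ q) ≡ H p q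

  -- How Kemeny's constant K of a graph with total degree V, obtained by attaching the cone over H to adj at v,
  -- splits: a i is the hitting time of v from i, R i j and Q p q are entries of the Green functions
  -- grounded at v (so R j j and Q p p are effective resistances to v), and 1 + x p is the hitting time of v from p.
  record Decomposition {n k : ℕ} (adj : Adj n) (v : Fin n) (H : Adj k) (V K : ℚ) : Set where
    field
      a    : Fin n → ℚ
      a-v  : a v ≡ 0ℚ
      Δa   : ∀ i → i ≢ v → Δ (weight adj) a i ≡ degree adj i
      R    : Fin n → Fin n → ℚ
      R-v  : ∀ j → R j v ≡ 0ℚ
      ΔR   : ∀ j i → i ≢ v → Δ (weight adj) (R j) i ≡ δ j i
      Q    : Fin k → Fin k → ℚ
      ΛQ   : ∀ p q → Λ (weight H) (Q p) q ≡ δ p q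
      x    : Fin k → ℚ
      Λx   : ∀ p → Λ (weight H) x p ≡ degree H p
      kemeny : V * K ≡ V * Σℚ n (λ j → degree adj j * R j j) - Σℚ n (λ j → degree adj j * a j)
                     + Σℚ k (λ p → (1ℚ + degree H p) * (V * Q p p - (1ℚ + x p)))

  ↑-elim : ∀ {n k} {P : Fin (n ℕ.+ k) → Set} → (∀ i → P (i ↑ˡ k)) → (∀ p → P (n ↑ʳ p)) → ∀ u → P u
  ↑-elim {n} {k} {P} f g u with splitAt n u in e
  ... | inj₁ i = subst P (splitAt⁻¹-↑ˡ e) (f i)
  ... | inj₂ p = subst P (splitAt⁻¹-↑ʳ e) (g p)

  ↑ˡ≢↑ʳ : ∀ {n k} {i : Fin n} {p : Fin k} → i ↑ˡ k ≢ n ↑ʳ p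
  ↑ˡ≢↑ʳ {n} {k} {i} {p} e with () ← trans (sym (splitAt-↑ˡ n i k)) (trans (cong (splitAt n) e) (splitAt-↑ʳ n k p))

  δ-injective : ∀ {m n} (f : Fin m → Fin n) → (∀ {i j} → f i ≡ f j → i ≡ j) → ∀ i j → δ (f i) (f j) ≡ δ i j
  δ-injective f inj i j with f i ≟ f j | i ≟ j
  ... | yes _ | yes _ = refl
  ... | no _  | no _  = refl
  ... | yes e | no ne = ⊥-elim (ne (inj e))
  ... | no ne | yes e = ⊥-elim (ne (cong f e))

  Σ-δ′ : ∀ {n} (v : Fin n) (f : Fin n → ℚ) → Σℚ n (λ i → δ i v * f i) ≡ f v
  Σ-δ′ v f = trans (Σ-cong (λ i → cong (_* f i) (δ-sym i v))) (Σ-δ v f)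

  module _ {n k : ℕ} {adj : Adj n} {v : Fin n} {H : Adj k} {G : Adj (n ℕ.+ k)}
           (attached : Attached adj v H G) (simple : IsSimple adj) (simple-H : IsSimple H)
           (walk : ∀ i → Walk adj i v) where
    open Attached attached
    private
      l : Fin n → Fin (n ℕ.+ k)
      l i = i ↑ˡ k
      r : Fin k → Fin (n ℕ.+ k)
      r p = n ↑ʳ p
      W = volume G

      w-ll : ∀ i j → weight G (l i) (l j) ≡ weight adj i j
      w-ll i j = cong bit (↑ˡ↑ˡ i j)
      w-lr : ∀ i p → weight G (l i) (r p) ≡ δ i v
      w-lr i p = cong bit (↑ˡ↑ʳ i p)
      w-rl : ∀ p i → weight G (r p) (l i) ≡ δ i v
      w-rl p i = cong bit (↑ʳ↑ˡ p i)
      w-rr : ∀ p q → weight G (r p) (r q) ≡ weight H p q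
      w-rr p q = cong bit (↑ʳ↑ʳ p q)

    attached-simple : IsSimple G
    attached-simple = record
      { symmetric = ↑-elim
          (λ i → ↑-elim (λ j → trans (↑ˡ↑ˡ i j) (trans (IsSimple.symmetric simple i j) (sym (↑ˡ↑ˡ j i))))
                        (λ q → trans (↑ˡ↑ʳ i q) (sym (↑ʳ↑ˡ q i))))
          (λ p → ↑-elim (λ j → trans (↑ʳ↑ˡ p j) (sym (↑ˡ↑ʳ j p)))
                        (λ q → trans (↑ʳ↑ʳ p q) (trans (IsSimple.symmetric simple-H p q) (sym (↑ʳ↑ʳ q p)))))
      ; irreflexive = ↑-elim (λ i → trans (↑ˡ↑ˡ i i) (IsSimple.irreflexive simple i))
                             (λ p → trans (↑ʳ↑ʳ p p) (IsSimple.irreflexive simple-H p))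
      }

    attached-walk : ∀ u → Walk G u (v ↑ˡ k)
    attached-walk = ↑-elim (λ i → lift (walk i)) (λ p → step (trans (↑ʳ↑ˡ p v) (dec-true (v ≟ v) refl)) here)
      where
      lift : ∀ {i j} → Walk adj i j → Walk G (l i) (l j)
      lift here                 = here
      lift (step {i} {j} e rest) = step (trans (↑ˡ↑ˡ i j) e) (lift rest)

    degree-l : ∀ i → degree G (l i) ≡ degree adj i + ℕ→ℚ k * δ i v
    degree-l i = trans (Σ-split n (weight G (l i)))
      (cong₂ _+_ (Σ-cong (w-ll i)) (trans (Σ-cong (w-lr i)) (Σ-const k (δ i v))))

    degree-r : ∀ p → degree G (r p) ≡ 1ℚ + degree H p
    degree-r p = trans (Σ-split n (weight G (r p)))
      (cong₂ _+_ (trans (Σ-cong (λ i → trans (w-rl p i) (sym (*-identityʳ (δ i v))))) (Σ-δ′ v (λ _ → 1ℚ))) (Σ-cong (w-rr p)))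

    attached-volume : volume G ≡ volume adj + ℕ→ℚ k + (ℕ→ℚ k + volume H)
    attached-volume = trans (Σ-split n (degree G)) (cong₂ _+_
      (trans (Σ-cong degree-l) (trans (Σ-+ (degree adj) (λ i → ℕ→ℚ k * δ i v)) (cong (volume adj +_)
        (trans (Σ-cong (λ i → solve 2 (λ a b → a :* b := b :* a) refl (ℕ→ℚ k) (δ i v))) (Σ-δ′ v (λ _ → ℕ→ℚ k))))))
      (trans (Σ-cong degree-r) (trans (Σ-+ (λ _ → 1ℚ) (degree H)) (cong (_+ volume H) (trans (Σ-const k 1ℚ) (*-identityʳ (ℕ→ℚ k)))))))

    private
      Δ-l : ∀ f i → i ≢ v → Δ (weight G) f (l i) ≡ Δ (weight adj) (λ j → f (l j)) i
      Δ-l f i i≢v = trans (Σ-split n (λ u → weight G (l i) u * (f (l i) - f u)))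
        (trans (cong₂ _+_ (Σ-cong (λ j → cong (_* (f (l i) - f (l j))) (w-ll i j)))
          (trans (Σ-cong (λ p → trans (cong (_* (f (l i) - f (r p))) (trans (w-lr i p) (δ-≢ i≢v))) (*-zeroˡ (f (l i) - f (r p))))) (Σ-zero k)))
          (+-identityʳ (Δ (weight adj) (λ j → f (l j)) i)))

      -- The only neighbour of `r p` outside the pendant vertices is `l v`. For `f` vanishing there,
      -- the right-hand side is Λ of the restriction of `f`.
      Δ-r : ∀ f p → Δ (weight G) f (r p) ≡ f (r p) - f (l v) + Δ (weight H) (λ q → f (r q)) p
      Δ-r f p = trans (Σ-split n (λ u → weight G (r p) u * (f (r p) - f u)))
        (cong₂ _+_ (trans (Σ-cong (λ i → cong (_* (f (r p) - f (l i))) (w-rl p i))) (Σ-δ′ v (λ i → f (r p) - f (l i))))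
          (Σ-cong (λ q → cong (_* (f (r p) - f (r q))) (w-rr p q))))

      δ-l : ∀ i j → δ (l i) (l j) ≡ δ i j
      δ-l = δ-injective l (λ {i} {j} → ↑ˡ-injective k i j)
      δ-r : ∀ p q → δ (r p) (r q) ≡ δ p q
      δ-r = δ-injective r (λ {p} {q} → ↑ʳ-injective n p q)

      δ-lr : ∀ p → δ (l v) (r p) ≡ 0ℚ
      δ-lr p = δ-≢ {i = l v} {r p} (↑ˡ≢↑ʳ {i = v} {p})

    decompose : ∀ {M} → IsHittingTimes G M → 0ℚ < volume G → ∀ u →
      Decomposition adj v H (volume G) (kemenyFrom G M u)
    decompose {M} hitting 0<V u = record
      { a    = a
      ; a-v  = M-diagonal G attached-simple hitting (l v)
      ; Δa   = λ i i≢v → trans (sym (Δ-l (λ u → M u (l v)) i i≢v)) (trans (Δ-hitting G attached-simple hitting (l v) (l i))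
                 (trans (cong₂ (λ d e → d - W * e) (degree-l i) (trans (δ-l v i) (trans (δ-sym v i) (δ-≢ i≢v))))
                 (trans (cong (λ e → degree adj i + ℕ→ℚ k * e - W * 0ℚ) (δ-≢ i≢v))
                   (solve 3 (λ d k W → d :+ k :* con 0ℚ :- W :* con 0ℚ := d) refl (degree adj i) (ℕ→ℚ k) W))))
      ; R    = R
      ; R-v  = λ j → trans (cong (V⁻¹ *_) (φ-v (l j))) (*-zeroʳ V⁻¹)
      ; ΔR   = λ j i i≢v → trans (Δ-scale (weight adj) (λ u → φ (l j) (l u)) i)
                 (trans (cong (V⁻¹ *_) (trans (sym (Δ-l (φ (l j)) i i≢v)) (trans (Δφ (l j) (l i))
                   (cong₂ (λ d e → W * (d - e)) (δ-l j i) (trans (δ-l v i) (trans (δ-sym v i) (δ-≢ i≢v)))))))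
                 (trans (solve 3 (λ c W d → c :* (W :* (d :- con 0ℚ)) := W :* c :* d) refl V⁻¹ W (δ j i))
                   (trans (cong (_* δ j i) V*V⁻¹) (*-identityˡ (δ j i)))))
      ; Q    = Q
      ; ΛQ   = λ p q → trans (cong (Q p q +_) (Δ-scale (weight H) (λ q → φ (r p) (r q)) q))
                 (trans (solve 3 (λ c f d → c :* f :+ c :* d := c :* (f :- con 0ℚ :+ d)) refl V⁻¹ (φ (r p) (r q)) (Δ (weight H) (λ q → φ (r p) (r q)) q))
                 (trans (cong (V⁻¹ *_) (trans (cong (λ e → φ (r p) (r q) - e + Δ (weight H) (λ q → φ (r p) (r q)) q) (sym (φ-v (r p))))
                     (trans (sym (Δ-r (φ (r p)) q)) (trans (Δφ (r p) (r q)) (cong₂ (λ d e → W * (d - e)) (δ-r p q) (δ-lr q))))))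
                 (trans (solve 3 (λ c W d → c :* (W :* (d :- con 0ℚ)) := W :* c :* d) refl V⁻¹ W (δ p q))
                   (trans (cong (_* δ p q) V*V⁻¹) (*-identityˡ (δ p q))))))
      ; x    = x
      ; Λx   = λ p → begin
          M (r p) (l v) - 1ℚ + Δ (weight H) x p
            ≡⟨ cong (M (r p) (l v) - 1ℚ +_) (Σ-cong (λ q → cong (weight H p q *_) (solve 2 (λ a b → a :- con 1ℚ :- (b :- con 1ℚ) := a :- b) refl (M (r p) (l v)) (M (r q) (l v))))) ⟩
          M (r p) (l v) - 1ℚ + Δ (weight H) (λ q → M (r q) (l v)) p
            ≡⟨ solve 2 (λ a b → a :- con 1ℚ :+ b := a :- con 0ℚ :+ b :- con 1ℚ) refl (M (r p) (l v)) (Δ (weight H) (λ q → M (r q) (l v)) p) ⟩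
          M (r p) (l v) - 0ℚ + Δ (weight H) (λ q → M (r q) (l v)) p - 1ℚ
            ≡⟨ cong (λ e → M (r p) (l v) - e + Δ (weight H) (λ q → M (r q) (l v)) p - 1ℚ) (sym (M-diagonal G attached-simple hitting (l v))) ⟩
          M (r p) (l v) - M (l v) (l v) + Δ (weight H) (λ q → M (r q) (l v)) p - 1ℚ
            ≡⟨ cong (_- 1ℚ) (trans (sym (Δ-r (λ u → M u (l v)) p)) (Δ-hitting G attached-simple hitting (l v) (r p))) ⟩
          degree G (r p) - W * δ (l v) (r p) - 1ℚ
            ≡⟨ cong₂ (λ d e → d - W * e - 1ℚ) (degree-r p) (δ-lr p) ⟩
          1ℚ + degree H p - W * 0ℚ - 1ℚ
            ≡⟨ solve 2 (λ d W → con 1ℚ :+ d :- W :* con 0ℚ :- con 1ℚ := d) refl (degree H p) W ⟩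
          degree H p ∎
      ; kemeny = begin
          W * kemenyFrom G M u
            ≡⟨ kemeny-formula G attached-simple hitting attached-walk 0<V u ⟩
          Σℚ (n ℕ.+ k) (λ u → degree G u * M (l v) u)
            ≡⟨ Σ-split n (λ u → degree G u * M (l v) u) ⟩
          Σℚ n (λ j → degree G (l j) * M (l v) (l j)) + Σℚ k (λ p → degree G (r p) * M (l v) (r p))
            ≡⟨ cong₂ _+_ (trans (Σ-cong left) (trans (Σ-*+ W (λ j → degree adj j * R j j) (λ j → - 1ℚ * (degree adj j * a j)))
                 (trans (cong (W * Σℚ n (λ j → degree adj j * R j j) +_) (Σ-* (- 1ℚ) (λ j → degree adj j * a j)))
                   (solve 2 (λ x y → x :+ con (- 1ℚ) :* y := x :- y) refl (W * Σℚ n (λ j → degree adj j * R j j)) (Σℚ n (λ j → degree adj j * a j))))))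
               (Σ-cong right) ⟩
          W * Σℚ n (λ j → degree adj j * R j j) - Σℚ n (λ j → degree adj j * a j)
            + Σℚ k (λ p → (1ℚ + degree H p) * (W * Q p p - (1ℚ + x p))) ∎
      }
      where
      open ≡-Reasoning
      V⁻¹ : ℚ
      V⁻¹ = (1/ W) {{pos⇒nonZero W {{positive 0<V}}}}
      V*V⁻¹ : W * V⁻¹ ≡ 1ℚ
      V*V⁻¹ = *-inverseʳ W {{pos⇒nonZero W {{positive 0<V}}}}
      φ = potential G attached-simple hitting (l v)
      φ-v = potential-v G attached-simple hitting (l v)
      Δφ = Δ-potential G attached-simple hitting (l v)
      a : Fin n → ℚ
      a i = M (l i) (l v)
      R : Fin n → Fin n → ℚ
      R j i = V⁻¹ * φ (l j) (l i)
      Q : Fin k → Fin k → ℚ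
      Q p q = V⁻¹ * φ (r p) (r q)
      -- On the pendant vertices Λ maps the hitting times of `v` to `1ℚ + degree H` and fixes the
      -- constant 1, so subtracting 1 leaves a solution of Λ x = h.
      x : Fin k → ℚ
      x p = M (r p) (l v) - 1ℚ
      Δ-scale : ∀ {m} (w : Fin m → Fin m → ℚ) f i → Δ w (λ j → V⁻¹ * f j) i ≡ V⁻¹ * Δ w f i
      Δ-scale w f i = trans (Σ-cong (λ j → solve 4 (λ w c a b → w :* (c :* a :- c :* b) := c :* (w :* (a :- b))) refl (w i j) V⁻¹ (f i) (f j)))
        (Σ-* V⁻¹ (λ j → w i j * (f i - f j)))
      unscale : ∀ y → W * (V⁻¹ * y) ≡ y
      unscale y = trans (solve 3 (λ a b c → a :* (b :* c) := a :* b :* c) refl W V⁻¹ y) (trans (cong (_* y) V*V⁻¹) (*-identityˡ y))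
      left : ∀ j → degree G (l j) * M (l v) (l j) ≡ W * (degree adj j * R j j) + - 1ℚ * (degree adj j * a j)
      left j = begin
        degree G (l j) * M (l v) (l j)
          ≡⟨ cong (_* M (l v) (l j)) (degree-l j) ⟩
        (degree adj j + ℕ→ℚ k * δ j v) * M (l v) (l j)
          ≡⟨ solve 4 (λ d k e m → (d :+ k :* e) :* m := d :* m :+ k :* (e :* m)) refl (degree adj j) (ℕ→ℚ k) (δ j v) (M (l v) (l j)) ⟩
        degree adj j * M (l v) (l j) + ℕ→ℚ k * (δ j v * M (l v) (l j))
          ≡⟨ cong₂ (λ m e → degree adj j * m + ℕ→ℚ k * e) (M≡potential G attached-simple hitting (l v) (l j)) at-v ⟩
        degree adj j * (φ (l j) (l j) - a j) + ℕ→ℚ k * 0ℚ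
          ≡⟨ cong (λ y → degree adj j * (y - a j) + ℕ→ℚ k * 0ℚ) (unscale (φ (l j) (l j))) ⟨
        degree adj j * (W * R j j - a j) + ℕ→ℚ k * 0ℚ
          ≡⟨ solve 5 (λ d W R a k → d :* (W :* R :- a) :+ k :* con 0ℚ := W :* (d :* R) :+ con (- 1ℚ) :* (d :* a)) refl (degree adj j) W (R j j) (a j) (ℕ→ℚ k) ⟩
        W * (degree adj j * R j j) + - 1ℚ * (degree adj j * a j) ∎
        where
        -- The `k` new edges raise the degree within `adj` only at `v`, where the factor
        -- `M (l v) (l v)` is 0.
        at-v : δ j v * M (l v) (l j) ≡ 0ℚ
        at-v with j ≟ v
        ... | yes refl = trans (*-identityˡ (M (l v) (l v))) (M-diagonal G attached-simple hitting (l v))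
        ... | no _     = *-zeroˡ (M (l v) (l j))
      right : ∀ p → degree G (r p) * M (l v) (r p) ≡ (1ℚ + degree H p) * (W * Q p p - (1ℚ + x p))
      right p = cong₂ _*_ (degree-r p) (trans (M≡potential G attached-simple hitting (l v) (r p))
        (cong₂ _-_ (sym (unscale (φ (r p) (r p)))) (solve 1 (λ a → a := con 1ℚ :+ (a :- con 1ℚ)) refl (M (r p) (l v)))))

-- The graph of the added pairs: edge count and size of components.

module PairGraph where
  open RationalArithmetic
  open FiniteSums
  open Laplacian
  open import Data.Nat as ℕ using (ℕ; zero; suc)
  open import Data.Fin using (Fin; zero; suc)
  open import Data.Fin.Properties using (_≟_)
  open import Data.Bool using (Bool; true; false; _∨_; _∧_; if_then_else_)
  open import Data.List using (List; []; _∷_; length)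
  open import Data.List.Relation.Unary.All using (All; []; _∷_)
  open import Data.List.Relation.Unary.AllPairs using (AllPairs; []; _∷_)
  open import Data.Product using (_×_; _,_; proj₁; proj₂)
  open import Data.Sum using (inj₁; inj₂)
  open import Data.Rational using (ℚ; 0ℚ; 1ℚ; _+_; _*_; _-_; -_; _≤_; _<_)
  open import Data.Rational.Properties using (+-identityʳ; *-identityʳ; ≤-trans; ≤-refl; ≤-reflexive)
  open import Data.Rational.Solver using (module +-*-Solver)
  open +-*-Solver using (solve; _:+_; _:*_; _:-_; :-_; _:=_; con)
  open import Relation.Binary.PropositionalEquality using (_≡_; _≢_; refl; sym; trans; cong; cong₂; subst; module ≡-Reasoning)
  open import Relation.Nullary using (¬_; yes; no; does)
  open import Relation.Nullary.Decidable using (dec-true)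
  open import Data.Empty using (⊥-elim)

  private variable
    k : ℕ

  memPair-sym : (L : List (Fin k × Fin k)) → ∀ p q → memPair L p q ≡ memPair L q p
  memPair-sym []            p q = refl
  memPair-sym ((a , b) ∷ L) p q rewrite memPair-sym L p q = swap (does (a ≟ p) ∧ does (b ≟ q)) (does (a ≟ q) ∧ does (b ≟ p)) (memPair L q p)
    where
    swap : ∀ x y z → x ∨ y ∨ z ≡ y ∨ x ∨ z
    swap true  true  z = refl
    swap true  false z = refl
    swap false true  z = refl
    swap false false z = refl

  memPair-irrefl : (L : List (Fin k × Fin k)) → All (λ pq → proj₁ pq ≢ proj₂ pq) L → ∀ p → memPair L p p ≡ false
  memPair-irrefl []            []         p = refl
  memPair-irrefl ((a , b) ∷ L) (a≢b ∷ ne) p with a ≟ p | b ≟ p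
  ... | yes a≡p | yes b≡p = ⊥-elim (a≢b (trans a≡p (sym b≡p)))
  ... | yes _   | no _    = memPair-irrefl L ne p
  ... | no _    | yes _   = memPair-irrefl L ne p
  ... | no _    | no _    = memPair-irrefl L ne p

  memPair-simple : (L : List (Fin k × Fin k)) → All (λ pq → proj₁ pq ≢ proj₂ pq) L → IsSimple (memPair L)
  memPair-simple L ne = record { symmetric = memPair-sym L ; irreflexive = memPair-irrefl L ne }

  memPair-fresh : (L : List (Fin k × Fin k)) → ∀ {p q} → All (λ ab → ¬ SamePair (p , q) ab) L → memPair L p q ≡ false
  memPair-fresh []            []          = refl
  memPair-fresh ((a , b) ∷ L) {p} {q} (new ∷ fresh) with a ≟ p | b ≟ q | a ≟ q | b ≟ p
  ... | yes a≡p | yes b≡q | _       | _       = ⊥-elim (new (inj₁ (sym a≡p , sym b≡q)))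
  ... | _       | _       | yes a≡q | yes b≡p = ⊥-elim (new (inj₂ (sym b≡p , sym a≡q)))
  ... | yes _   | no _    | yes _   | no _    = memPair-fresh L fresh
  ... | yes _   | no _    | no _    | _       = memPair-fresh L fresh
  ... | no _    | _       | yes _   | no _    = memPair-fresh L fresh
  ... | no _    | _       | no _    | _       = memPair-fresh L fresh

  -- The disjunction turns into a sum since at most one of its three parts holds: `a ≢ b` excludes
  -- both orientations at once, and freshness excludes that the pair already occurs in `L`. This is
  -- how distinctness of the pairs enters the edge count.
  weight-∷ : ∀ {a b : Fin k} {L} → a ≢ b → All (λ cd → ¬ SamePair (a , b) cd) L → ∀ p q →
    weight (memPair ((a , b) ∷ L)) p q ≡ δ a p * δ b q + (δ a q * δ b p + weight (memPair L) p q)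
  weight-∷ {a = a} {b} {L} a≢b fresh p q with a ≟ p | b ≟ q | a ≟ q | b ≟ p
  ... | yes refl | yes refl | yes a≡b  | _        = ⊥-elim (a≢b a≡b)
  ... | yes refl | yes refl | no _     | yes b≡a  = ⊥-elim (a≢b (sym b≡a))
  ... | yes refl | yes refl | no _     | no _     rewrite memPair-fresh L fresh = refl
  ... | yes refl | no _     | yes refl | yes b≡a  = ⊥-elim (a≢b (sym b≡a))
  ... | no _     | yes refl | yes a≡b  | yes refl = ⊥-elim (a≢b a≡b)
  ... | no _     | no _     | yes refl | yes refl rewrite memPair-sym L b a | memPair-fresh L fresh = refl
  ... | yes _    | no _     | yes _    | no _     = solve 1 (λ x → x := con 1ℚ :* con 0ℚ :+ (con 1ℚ :* con 0ℚ :+ x)) refl (weight (memPair L) p q)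
  ... | yes _    | no _     | no _     | yes _    = solve 1 (λ x → x := con 1ℚ :* con 0ℚ :+ (con 0ℚ :* con 1ℚ :+ x)) refl (weight (memPair L) p q)
  ... | yes _    | no _     | no _     | no _     = solve 1 (λ x → x := con 1ℚ :* con 0ℚ :+ (con 0ℚ :* con 0ℚ :+ x)) refl (weight (memPair L) p q)
  ... | no _     | yes _    | yes _    | no _     = solve 1 (λ x → x := con 0ℚ :* con 1ℚ :+ (con 1ℚ :* con 0ℚ :+ x)) refl (weight (memPair L) p q)
  ... | no _     | yes _    | no _     | yes _    = solve 1 (λ x → x := con 0ℚ :* con 1ℚ :+ (con 0ℚ :* con 1ℚ :+ x)) refl (weight (memPair L) p q)
  ... | no _     | yes _    | no _     | no _     = solve 1 (λ x → x := con 0ℚ :* con 1ℚ :+ (con 0ℚ :* con 0ℚ :+ x)) refl (weight (memPair L) p q)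
  ... | no _     | no _     | yes _    | no _     = solve 1 (λ x → x := con 0ℚ :* con 0ℚ :+ (con 1ℚ :* con 0ℚ :+ x)) refl (weight (memPair L) p q)
  ... | no _     | no _     | no _     | yes _    = solve 1 (λ x → x := con 0ℚ :* con 0ℚ :+ (con 0ℚ :* con 1ℚ :+ x)) refl (weight (memPair L) p q)
  ... | no _     | no _     | no _     | no _     = solve 1 (λ x → x := con 0ℚ :* con 0ℚ :+ (con 0ℚ :* con 0ℚ :+ x)) refl (weight (memPair L) p q)

  Σ-δ-1 : (a : Fin k) → Σℚ k (δ a) ≡ 1ℚ
  Σ-δ-1 a = trans (Σ-cong (λ p → sym (*-identityʳ (δ a p)))) (Σ-δ a (λ _ → 1ℚ))

  memPair-volume : (L : List (Fin k × Fin k)) → All (λ pq → proj₁ pq ≢ proj₂ pq) L → AllPairs (λ a b → ¬ SamePair a b) L →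
    volume (memPair L) ≡ ℕ→ℚ (length L) + ℕ→ℚ (length L)
  memPair-volume {k} [] [] [] = trans (Σ-cong {k} (λ p → Σ-zero k)) (Σ-zero k)
  memPair-volume {k} ((a , b) ∷ L) (a≢b ∷ ne) (fresh ∷ distinct) = begin
    volume (memPair ((a , b) ∷ L))
      ≡⟨ Σ-cong row ⟩
    Σℚ k (λ p → δ a p + (δ b p + degree (memPair L) p))
      ≡⟨ trans (Σ-+ (δ a) (λ p → δ b p + degree (memPair L) p)) (cong₂ _+_ (Σ-δ-1 a) (trans (Σ-+ (δ b) (degree (memPair L))) (cong₂ _+_ (Σ-δ-1 b) (memPair-volume L ne distinct)))) ⟩
    1ℚ + (1ℚ + (ℓ + ℓ))
      ≡⟨ solve 1 (λ ℓ → con 1ℚ :+ (con 1ℚ :+ (ℓ :+ ℓ)) := (con 1ℚ :+ ℓ) :+ (con 1ℚ :+ ℓ)) refl ℓ ⟩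
    (1ℚ + ℓ) + (1ℚ + ℓ)
      ≡⟨ cong₂ _+_ (sym (ℕ→ℚ-homo-+ 1 (length L))) (sym (ℕ→ℚ-homo-+ 1 (length L))) ⟩
    ℕ→ℚ (suc (length L)) + ℕ→ℚ (suc (length L)) ∎
    where
    open ≡-Reasoning
    ℓ = ℕ→ℚ (length L)
    row : ∀ p → degree (memPair ((a , b) ∷ L)) p ≡ δ a p + (δ b p + degree (memPair L) p)
    row p = trans (Σ-cong (λ q → trans (weight-∷ a≢b fresh p q)
        (cong (δ a p * δ b q +_) (cong (_+ weight (memPair L) p q) (solve 2 (λ x y → x :* y := y :* x) refl (δ a q) (δ b p))))))
      (trans (Σ-*+ (δ a p) (δ b) (λ q → δ b p * δ a q + weight (memPair L) p q))
        (cong₂ _+_ (trans (cong (δ a p *_) (Σ-δ-1 b)) (*-identityʳ (δ a p)))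
          (trans (Σ-*+ (δ b p) (δ a) (weight (memPair L) p)) (cong (_+ degree (memPair L) p) (trans (cong (δ b p *_) (Σ-δ-1 a)) (*-identityʳ (δ b p)))))))

  -- Union–find: merging along each pair in turn gives a labelling that is constant on the components.
  -- Each merge destroys at most one fixed point, and a class contains at most one.
  label : List (Fin k × Fin k) → Fin k → Fin k
  label []            u = u
  label ((a , b) ∷ L) u = if does (label L u ≟ label L b) then label L a else label L u

  label-edge : (L : List (Fin k × Fin k)) → ∀ p q → memPair L p q ≡ true → label L p ≡ label L q
  label-edge ((a , b) ∷ L) p q e with a ≟ p | b ≟ q | a ≟ q | b ≟ p
  ... | yes refl | yes refl | _        | _        = merged
    where
    merged : label ((a , b) ∷ L) a ≡ label ((a , b) ∷ L) b
    merged rewrite dec-true (label L b ≟ label L b) refl with does (label L a ≟ label L b)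
    ... | true  = refl
    ... | false = refl
  ... | _        | _        | yes refl | yes refl = merged
    where
    merged : label ((a , b) ∷ L) b ≡ label ((a , b) ∷ L) a
    merged rewrite dec-true (label L b ≟ label L b) refl with does (label L a ≟ label L b)
    ... | true  = refl
    ... | false = refl
  ... | yes _    | no _     | yes _    | no _     rewrite label-edge L p q e = refl
  ... | yes _    | no _     | no _     | _        rewrite label-edge L p q e = refl
  ... | no _     | _        | yes _    | no _     rewrite label-edge L p q e = refl
  ... | no _     | _        | no _     | _        rewrite label-edge L p q e = refl

  0≤δ : (i j : Fin k) → 0ℚ ≤ δ i j
  0≤δ i j = 0≤bit (does (i ≟ j))

  label-fixed : (L : List (Fin k × Fin k)) → ℕ→ℚ k ≤ Σℚ k (λ u → δ (label L u) u) + ℕ→ℚ (length L)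
  label-fixed {k} [] = ≤-reflexive (sym (trans (+-identityʳ (Σℚ k (λ u → δ u u))) (trans (Σ-cong {k} δ-refl) (trans (Σ-const k 1ℚ) (*-identityʳ (ℕ→ℚ k))))))
  label-fixed {k} ((a , b) ∷ L) = ≤-trans (label-fixed L) (0≤b-a⇒a≤b (subst (0ℚ ≤_)
    (trans (solve 3 (λ x y ℓ → x :+ con 1ℚ :- y := x :+ (con 1ℚ :+ ℓ) :- (y :+ ℓ)) refl fixed′ fixed (ℕ→ℚ (length L)))
      (cong (λ e → fixed′ + e - (fixed + ℕ→ℚ (length L))) (sym (ℕ→ℚ-homo-+ 1 (length L)))))
    (0≤b-a total)))
    where
    fixed fixed′ : ℚ
    fixed  = Σℚ k (λ u → δ (label L u) u)
    fixed′ = Σℚ k (λ u → δ (label ((a , b) ∷ L) u) u)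
    -- Only vertices labelled `label L b` are relabelled, and the only one of them that can be a
    -- fixed point is `label L b` itself.
    pointwise : ∀ u → δ (label L u) u ≤ δ (label ((a , b) ∷ L) u) u + δ (label L b) u
    pointwise u with label L u ≟ label L b
    ... | yes e = a≤a+b (0≤δ (label L a) u) (trans (cong (λ c → δ c u + δ (label L a) u) e)
                    (solve 2 (λ x y → x :+ y := y :+ x) refl (δ (label L b) u) (δ (label L a) u)))
    ... | no _  = a≤a+b (0≤δ (label L b) u) refl
    total : fixed ≤ fixed′ + 1ℚ
    total = subst (fixed ≤_) (trans (Σ-+ (λ u → δ (label ((a , b) ∷ L) u) u) (δ (label L b))) (cong (fixed′ +_) (Σ-δ-1 (label L b))))
      (Σ-mono pointwise)

  class : List (Fin k × Fin k) → Fin k → Fin k → Bool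
  class L p u = does (label L u ≟ label L p)

  class-closed : (L : List (Fin k × Fin k)) → ∀ p i j → memPair L i j ≡ true → class L p i ≡ class L p j
  class-closed L p i j e = cong (λ c → does (c ≟ label L p)) (label-edge L i j e)

  class-self : (L : List (Fin k × Fin k)) → ∀ p → class L p p ≡ true
  class-self L p = dec-true (label L p ≟ label L p) refl

  -- Only the common label of a class can be a fixed point in it, so class and fixed points overlap
  -- in at most one vertex. Since at least `k - length L` vertices are fixed, at most `length L + 1`
  -- remain for the class.
  class-size : (L : List (Fin k × Fin k)) → ∀ p → Σℚ k (λ u → bit (class L p u)) ≤ ℕ→ℚ (suc (length L))
  class-size {k} L p = 0≤b-a⇒a≤b (subst (0ℚ ≤_)
    (trans (solve 4 (λ κ s φ ℓ → (κ :+ con 1ℚ :- (s :+ φ)) :+ (φ :+ ℓ :- κ) := con 1ℚ :+ ℓ :- s) refl (ℕ→ℚ k) size fixed (ℕ→ℚ (length L)))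
      (cong (_- size) (sym (ℕ→ℚ-homo-+ 1 (length L)))))
    (0≤a+b (0≤b-a total) (0≤b-a (label-fixed L))))
    where
    size fixed : ℚ
    size  = Σℚ k (λ u → bit (class L p u))
    fixed = Σℚ k (λ u → δ (label L u) u)
    pointwise : ∀ u → bit (class L p u) + δ (label L u) u ≤ 1ℚ + δ (label L p) u
    pointwise u with label L u ≟ label L p | label L u ≟ u | label L p ≟ u
    ... | yes e | yes f | no ne = ⊥-elim (ne (trans (sym e) f))
    ... | yes _ | yes _ | yes _ = ≤-refl
    ... | yes _ | no _  | yes _ = a≤a+b 0≤1 refl
    ... | yes _ | no _  | no _  = ≤-refl
    ... | no _  | yes _ | yes _ = a≤a+b 0≤1 refl
    ... | no _  | yes _ | no _  = ≤-refl
    ... | no _  | no _  | yes _ = a≤a+b (0≤ℕ→ℚ 2) refl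
    ... | no _  | no _  | no _  = 0≤1
    total : size + fixed ≤ ℕ→ℚ k + 1ℚ
    total = subst (_≤ ℕ→ℚ k + 1ℚ) (Σ-+ (λ u → bit (class L p u)) (λ u → δ (label L u) u))
      (subst (Σℚ k (λ u → bit (class L p u) + δ (label L u) u) ≤_)
        (trans (Σ-+ (λ _ → 1ℚ) (δ (label L p))) (cong₂ _+_ (trans (Σ-const k 1ℚ) (*-identityʳ (ℕ→ℚ k))) (Σ-δ-1 (label L p))))
        (Σ-mono pointwise))

  subset-size : (C : Fin k → Bool) → Σℚ k (λ u → bit (C u)) ≤ ℕ→ℚ k
  subset-size {k} C = subst (Σℚ k (λ u → bit (C u)) ≤_) (trans (Σ-const k 1ℚ) (*-identityʳ (ℕ→ℚ k))) (Σ-mono pointwise)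
    where
    pointwise : ∀ u → bit (C u) ≤ 1ℚ
    pointwise u with C u
    ... | true  = ≤-refl
    ... | false = 0≤1

  -- Two vertices span a single pair. This removes `k = 2` from the case of many pairs, where the
  -- numerical hypothesis would be too weak.
  two-points : 2 ≡ k → (L : List (Fin k × Fin k)) → All (λ pq → proj₁ pq ≢ proj₂ pq) L → AllPairs (λ a b → ¬ SamePair a b) L → length L ℕ.< k
  two-points refl []          _ _ = ℕ.s≤s ℕ.z≤n
  two-points refl (_ ∷ [])    _ _ = ℕ.s≤s (ℕ.s≤s ℕ.z≤n)
  two-points refl (x ∷ y ∷ L) (x≢ ∷ y≢ ∷ _) ((new ∷ _) ∷ _) = ⊥-elim (new (same x y x≢ y≢))
    where
    same : ∀ (x y : Fin 2 × Fin 2) → proj₁ x ≢ proj₂ x → proj₁ y ≢ proj₂ y → SamePair x y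
    same (zero , zero) _ x≢ _ = ⊥-elim (x≢ refl)
    same (suc zero , suc zero) _ x≢ _ = ⊥-elim (x≢ refl)
    same _ (zero , zero) _ y≢ = ⊥-elim (y≢ refl)
    same _ (suc zero , suc zero) _ y≢ = ⊥-elim (y≢ refl)
    same (zero , suc zero) (zero , suc zero) _ _ = inj₁ (refl , refl)
    same (zero , suc zero) (suc zero , zero) _ _ = inj₂ (refl , refl)
    same (suc zero , zero) (zero , suc zero) _ _ = inj₂ (refl , refl)
    same (suc zero , zero) (suc zero , zero) _ _ = inj₁ (refl , refl)

-- From the quadratic hypotheses on m to a linear inequality.

module Threshold where
  open import Data.Nat using (zero; suc; _+_; _*_; _^_; _≤_; _<_; s≤s; _<?_)
  open import Data.Nat.Properties
  open import Data.Nat.Solver using (module +-*-Solver)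
  open +-*-Solver using (solve; _:+_; _:*_; _:^_; _:=_; con)
  open import Data.Nat.Tactic.RingSolver using (solve-∀)
  open import Relation.Binary.PropositionalEquality using (_≡_; refl; cong)
  open import Relation.Nullary using (yes; no)
  open import Data.Empty using (⊥; ⊥-elim)

  4m≤7⇒m≤1 : ∀ m → 4 * m ≤ 7 → m ≤ 1
  4m≤7⇒m≤1 m p = ≤-pred (*-cancelˡ-< 4 m 2 (s≤s p))

  -- Expanded, the hypothesis reads 4m² + (l + 1) m > (l + 1)(2l + 1). If the conclusion failed, k ≥
  -- l + 1 would give 4m ≤ l + 4, so 8m + l + 1 ≤ 3l + 9, whose square has leading coefficient 9
  -- against 33.
  few-pairs : ∀ m k l → 1 ≤ l → l < k → 33 * l ^ 2 + 50 * l + 17 < (8 * m + l + 1) ^ 2 → 3 * (suc l + 1) < 2 * (2 * m + k)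
  few-pairs m k l 1≤l l<k hyp with 3 * (suc l + 1) <? 2 * (2 * m + k)
  ... | yes p = p
  ... | no ¬p = ⊥-elim (absurd l 1≤l 4m≤l+4 hyp)
    where
    open ≤-Reasoning
    4m≤l+4 : 4 * m ≤ l + 4
    4m≤l+4 = +-cancelʳ-≤ (2 * suc l) (4 * m) (l + 4) (begin
      4 * m + 2 * suc l       ≤⟨ +-monoʳ-≤ (4 * m) (*-monoʳ-≤ 2 l<k) ⟩
      4 * m + 2 * k           ≡⟨ eq₁ m k ⟩
      2 * (2 * m + k)         ≤⟨ ≮⇒≥ ¬p ⟩
      3 * (suc l + 1)         ≡⟨ eq₂ l ⟩
      l + 4 + 2 * suc l       ∎)
      where
      eq₁ : ∀ m k → 4 * m + 2 * k ≡ 2 * (2 * m + k)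
      eq₁ = solve-∀
      eq₂ : ∀ l → 3 * (suc l + 1) ≡ l + 4 + 2 * suc l
      eq₂ = solve-∀
    absurd : ∀ l → 1 ≤ l → 4 * m ≤ l + 4 → 33 * l ^ 2 + 50 * l + 17 < (8 * m + l + 1) ^ 2 → ⊥
    -- For l = 1 the bound 3l + 9 = 12 is too weak, as 144 > 100. Integrality sharpens 4m ≤ 5 to m ≤
    -- 1, and then both sides are exactly 100.
    absurd (suc zero) _ p q = <-irrefl refl (<-≤-trans q (begin
      (8 * m + 1 + 1) ^ 2     ≤⟨ ^-monoˡ-≤ 2 (+-monoˡ-≤ 1 (+-monoˡ-≤ 1 (*-monoʳ-≤ 8 (4m≤7⇒m≤1 m (≤-trans p (m≤m+n 5 2)))))) ⟩
      100                     ∎))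
    absurd (suc (suc j)) _ p q = <-irrefl refl (<-≤-trans q (begin
      (8 * m + (2 + j) + 1) ^ 2            ≡⟨ cong (λ x → (x + (2 + j) + 1) ^ 2) (eq₃ m) ⟩
      (2 * (4 * m) + (2 + j) + 1) ^ 2      ≤⟨ ^-monoˡ-≤ 2 (+-monoˡ-≤ 1 (+-monoˡ-≤ (2 + j) (*-monoʳ-≤ 2 p))) ⟩
      -- The added polynomial is the exact difference of the two sides at l = 2 + j; starting from 2
      -- makes all its coefficients natural numbers.
      (2 * (2 + j + 4) + (2 + j) + 1) ^ 2  ≤⟨ m≤m+n _ (24 * (j * j) + 92 * j + 24) ⟩
      (2 * (2 + j + 4) + (2 + j) + 1) ^ 2 + (24 * (j * j) + 92 * j + 24) ≡⟨ eq₄ j ⟩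
      33 * (2 + j) ^ 2 + 50 * (2 + j) + 17 ∎))
      where
      eq₃ : ∀ m → 8 * m ≡ 2 * (4 * m)
      eq₃ = solve-∀
      eq₄ : ∀ j → (2 * (2 + j + 4) + (2 + j) + 1) ^ 2 + (24 * (j * j) + 92 * j + 24) ≡ 33 * (2 + j) ^ 2 + 50 * (2 + j) + 17
      eq₄ = solve 1 (λ j → (con 2 :* (con 2 :+ j :+ con 4) :+ (con 2 :+ j) :+ con 1) :^ 2 :+ (con 24 :* (j :* j) :+ con 92 :* j :+ con 24) := con 33 :* (con 2 :+ j) :^ 2 :+ con 50 :* (con 2 :+ j) :+ con 17) refl

  -- Expanded, the hypothesis reads 4m² + (k + 1) m > 2k (k - 1), and failure of the conclusion
  -- means 4m ≤ k + 3. The bound `3 ≤ k` matters: for k = 2 and m = 1 the hypothesis is 133 < 181,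
  -- yet the conclusion would be 9 < 8.
  many-pairs : ∀ m k → 3 ≤ k → 33 * k ^ 2 + 1 < (8 * m + k + 1) ^ 2 + 30 * k → 3 * (k + 1) < 2 * (2 * m + k)
  many-pairs m k 3≤k hyp with 3 * (k + 1) <? 2 * (2 * m + k)
  ... | yes p = p
  ... | no ¬p = ⊥-elim (absurd k 3≤k 4m≤k+3 hyp)
    where
    open ≤-Reasoning
    4m≤k+3 : 4 * m ≤ k + 3
    4m≤k+3 = +-cancelʳ-≤ (2 * k) (4 * m) (k + 3) (begin
      4 * m + 2 * k           ≡⟨ eq₁ m k ⟩
      2 * (2 * m + k)         ≤⟨ ≮⇒≥ ¬p ⟩
      3 * (k + 1)             ≡⟨ eq₂ k ⟩
      k + 3 + 2 * k           ∎)
      where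
      eq₁ : ∀ m k → 4 * m + 2 * k ≡ 2 * (2 * m + k)
      eq₁ = solve-∀
      eq₂ : ∀ k → 3 * (k + 1) ≡ k + 3 + 2 * k
      eq₂ = solve-∀
    absurd : ∀ k → 3 ≤ k → 4 * m ≤ k + 3 → 33 * k ^ 2 + 1 < (8 * m + k + 1) ^ 2 + 30 * k → ⊥
    absurd (suc zero) (s≤s ()) _ _
    absurd (suc (suc zero)) (s≤s (s≤s ())) _ _
    -- For k = 3 the bound 8m ≤ 2k + 6 would only give 346, above 298; integrality sharpens 4m ≤ 6
    -- to m ≤ 1 and gives 234.
    absurd (suc (suc (suc zero))) _ p q = <-irrefl refl (<-≤-trans q (begin
      (8 * m + 3 + 1) ^ 2 + 90 ≤⟨ +-monoˡ-≤ 90 (^-monoˡ-≤ 2 (+-monoˡ-≤ 1 (+-monoˡ-≤ 3 (*-monoʳ-≤ 8 (4m≤7⇒m≤1 m (≤-trans p (m≤m+n 6 1))))))) ⟩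
      234                      ≤⟨ m≤m+n 234 64 ⟩
      298                      ∎))
    absurd (suc (suc (suc (suc j)))) _ p q = <-irrefl refl (<-≤-trans q (begin
      (8 * m + (4 + j) + 1) ^ 2 + 30 * (4 + j)            ≡⟨ cong (λ x → (x + (4 + j) + 1) ^ 2 + 30 * (4 + j)) (eq₃ m) ⟩
      (2 * (4 * m) + (4 + j) + 1) ^ 2 + 30 * (4 + j)      ≤⟨ +-monoˡ-≤ (30 * (4 + j)) (^-monoˡ-≤ 2 (+-monoˡ-≤ 1 (+-monoˡ-≤ (4 + j) (*-monoʳ-≤ 2 p)))) ⟩
      (2 * (4 + j + 3) + (4 + j) + 1) ^ 2 + 30 * (4 + j)  ≤⟨ m≤m+n _ (24 * (j * j) + 120 * j + 48) ⟩
      (2 * (4 + j + 3) + (4 + j) + 1) ^ 2 + 30 * (4 + j) + (24 * (j * j) + 120 * j + 48) ≡⟨ eq₄ j ⟩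
      33 * (4 + j) ^ 2 + 1 ∎))
      where
      eq₃ : ∀ m → 8 * m ≡ 2 * (4 * m)
      eq₃ = solve-∀
      eq₄ : ∀ j → (2 * (4 + j + 3) + (4 + j) + 1) ^ 2 + 30 * (4 + j) + (24 * (j * j) + 120 * j + 48) ≡ 33 * (4 + j) ^ 2 + 1
      eq₄ = solve 1 (λ j → (con 2 :* (con 4 :+ j :+ con 3) :+ (con 4 :+ j) :+ con 1) :^ 2 :+ con 30 :* (con 4 :+ j) :+ (con 24 :* (j :* j) :+ con 120 :* j :+ con 48) := con 33 :* (con 4 :+ j) :^ 2 :+ con 1) refl

-- Comparison of the two Kemeny constants.

module Comparison where
  open RationalArithmetic
  open FiniteSums
  open Laplacian
  open Grounded
  open HittingTimes
  open Attachment
  open PairGraph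
  open import Data.Nat as ℕ using (ℕ)
  open import Data.Fin using (Fin; _↑ˡ_; _↑ʳ_)
  open import Data.Fin.Properties using (_≟_; splitAt-↑ˡ; splitAt-↑ʳ)
  open import Data.Bool using (Bool; true; false)
  open import Data.List using (List; length)
  open import Data.Product using (_×_; proj₁; proj₂)
  open import Data.List.Relation.Unary.All using (All)
  open import Data.List.Relation.Unary.AllPairs using (AllPairs)
  open import Data.Rational using (ℚ; 0ℚ; 1ℚ; _+_; _*_; _-_; -_; _≤_; _<_)
  open import Data.Rational.Properties using (+-identityˡ; +-identityʳ; *-zeroˡ; *-identityˡ; ≤-reflexive; <-≤-trans; <⇒≤; +-mono-≤-<)
  open import Data.Rational.Solver using (module +-*-Solver)
  open +-*-Solver using (solve; _:+_; _:*_; _:-_; :-_; _:=_; con)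
  open import Relation.Binary.PropositionalEquality using (_≡_; _≢_; refl; sym; trans; cong; cong₂; subst; subst₂; module ≡-Reasoning)
  open import Relation.Nullary using (¬_; yes; no; does)

  noEdges : ∀ {k} → Adj k
  noEdges _ _ = false

  noEdges-simple : ∀ {k} → IsSimple (noEdges {k})
  noEdges-simple = record { symmetric = λ _ _ → refl ; irreflexive = λ _ → refl }

  noEdges-degree : ∀ {k} (p : Fin k) → degree noEdges p ≡ 0ℚ
  noEdges-degree {k} _ = Σ-zero k

  noEdges-volume : ∀ k → volume (noEdges {k}) ≡ 0ℚ
  noEdges-volume k = trans (Σ-cong (noEdges-degree {k})) (Σ-zero k)

  attachStar-attached : ∀ {n} k (adj : Adj n) v → Attached adj v noEdges (attachStar k adj v)
  attachStar-attached {n} k adj v = record { ↑ˡ↑ˡ = ll ; ↑ˡ↑ʳ = lr ; ↑ʳ↑ˡ = rl ; ↑ʳ↑ʳ = rr }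
    where
    ll : ∀ i j → attachStar k adj v (i ↑ˡ k) (j ↑ˡ k) ≡ adj i j
    ll i j rewrite splitAt-↑ˡ n i k | splitAt-↑ˡ n j k = refl
    lr : ∀ i q → attachStar k adj v (i ↑ˡ k) (n ↑ʳ q) ≡ does (i ≟ v)
    lr i q rewrite splitAt-↑ˡ n i k | splitAt-↑ʳ n k q = refl
    rl : ∀ p j → attachStar k adj v (n ↑ʳ p) (j ↑ˡ k) ≡ does (j ≟ v)
    rl p j rewrite splitAt-↑ˡ n j k | splitAt-↑ʳ n k p = refl
    rr : ∀ p q → attachStar k adj v (n ↑ʳ p) (n ↑ʳ q) ≡ false
    rr p q rewrite splitAt-↑ʳ n k p | splitAt-↑ʳ n k q = refl

  addPendantPairs-attached : ∀ {n k} {adj : Adj n} {v} {G : Adj (n ℕ.+ k)} (L : List (Fin k × Fin k)) →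
    Attached adj v noEdges G → Attached adj v (memPair L) (addPendantPairs {n} {k} G L)
  addPendantPairs-attached {n} {k} {adj} {v} {G} L attached = record { ↑ˡ↑ˡ = ll ; ↑ˡ↑ʳ = lr ; ↑ʳ↑ˡ = rl ; ↑ʳ↑ʳ = rr }
    where
    open Attached attached
    G′ : Adj (n ℕ.+ k)
    G′ = addPendantPairs {n} {k} G L
    ll : ∀ i j → G′ (i ↑ˡ k) (j ↑ˡ k) ≡ adj i j
    ll i j rewrite splitAt-↑ˡ n i k = ↑ˡ↑ˡ i j
    lr : ∀ i q → G′ (i ↑ˡ k) (n ↑ʳ q) ≡ does (i ≟ v)
    lr i q rewrite splitAt-↑ˡ n i k = ↑ˡ↑ʳ i q
    rl : ∀ p j → G′ (n ↑ʳ p) (j ↑ˡ k) ≡ does (j ≟ v)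
    rl p j rewrite splitAt-↑ˡ n j k | splitAt-↑ʳ n k p = ↑ʳ↑ˡ p j
    rr : ∀ p q → G′ (n ↑ʳ p) (n ↑ʳ q) ≡ memPair L p q
    rr p q rewrite splitAt-↑ʳ n k p | splitAt-↑ʳ n k q | ↑ʳ↑ʳ p q = refl

  module _ {n : ℕ} {adj : Adj n} (simple : IsSimple adj) {v : Fin n} (walk : ∀ i → Walk adj i v) where

    private
      w : Fin n → Fin n → ℚ
      w = weight adj
      d : Fin n → ℚ
      d = degree adj

    -- The decompositions of the two graphs impose the same equations on G₁ away from `v` and the
    -- same value at `v`, so this identifies their hitting times `a` and their Green functions `R`.
    Δ-unique : ∀ {f g : Fin n → ℚ} → f v ≡ g v → (∀ i → i ≢ v → Δ w f i ≡ Δ w g i) → ∀ i → f i ≡ g i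
    Δ-unique {f} {g} fv≡gv Δf≡Δg i = trans (solve 2 (λ a b → a := (con 1ℚ :* a :+ con (- 1ℚ) :* b) :+ b) refl (f i) (g i))
      (trans (cong (_+ g i) (harmonic⇒zero walk {λ j → 1ℚ * f j + - 1ℚ * g j}
          (λ j j≢v → trans (Δ-linear w 1ℚ f (- 1ℚ) g j) (cancel (Δf≡Δg j j≢v))) (cancel fv≡gv) i))
        (+-identityˡ (g i)))
      where
      cancel : ∀ {a b} → a ≡ b → 1ℚ * a + - 1ℚ * b ≡ 0ℚ
      cancel {a} refl = solve 1 (λ a → con 1ℚ :* a :+ con (- 1ℚ) :* a := con 0ℚ) refl a

    0≤degree : ∀ i → 0ℚ ≤ d i
    0≤degree i = 0≤Σ (0≤weight adj i)

    -- Every edge at `v` is counted a second time in the degree of its other end.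
    2d≤volume : d v + d v ≤ volume adj
    2d≤volume = subst (_≤ volume adj) total (Σ-mono pointwise)
      where
      pointwise : ∀ i → δ v i * d i + w v i ≤ d i
      pointwise i with v ≟ i
      ... | yes refl = ≤-reflexive (trans (cong (1ℚ * d v +_) (weight-irrefl adj simple v)) (solve 1 (λ a → con 1ℚ :* a :+ con 0ℚ := a) refl (d v)))
      ... | no _     = subst (_≤ d i)
        (trans (Σ-δ v (w i)) (trans (weight-sym adj simple i v) (solve 2 (λ a b → a := con 0ℚ :* b :+ a) refl (w v i) (d i))))
        (Σ-mono shrink)
        where
        shrink : ∀ j → δ v j * w i j ≤ w i j
        shrink j with does (v ≟ j)
        ... | true  = ≤-reflexive (*-identityˡ (w i j))
        ... | false = subst (_≤ w i j) (sym (*-zeroˡ (w i j))) (0≤weight adj i j)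
      total : Σℚ n (λ i → δ v i * d i + w v i) ≡ d v + d v
      total = trans (Σ-+ (λ i → δ v i * d i) (w v)) (cong (_+ d v) (Σ-δ v d))

    -- Away from v every hitting time is at least 1, and the degrees away from v add up to at least the number of edges.
    hitting-moment : ∀ {a : Fin n → ℚ} → a v ≡ 0ℚ → (∀ i → i ≢ v → Δ w a i ≡ d i) →
      volume adj ≤ Σℚ n (λ i → d i * a i) + Σℚ n (λ i → d i * a i)
    hitting-moment {a} a-v Δa = 0≤b-a⇒a≤b (subst (0ℚ ≤_)
      (solve 3 (λ V T x → (T :- (V :- x)) :+ (T :- (V :- x)) :+ (V :- (x :+ x)) := T :+ T :- V) refl (volume adj) T (d v))
      (0≤a+b (0≤a+b (0≤b-a T≥) (0≤b-a T≥)) (0≤b-a 2d≤volume)))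
      where
      T = Σℚ n (λ i → d i * a i)
      0≤a : ∀ i → 0ℚ ≤ a i
      0≤a = minimum-principle walk (λ i i≢v → subst (0ℚ ≤_) (sym (Δa i i≢v)) (0≤degree i)) (≤-reflexive (sym a-v))
      pointwise : ∀ i → d i - δ v i * d i ≤ d i * a i
      pointwise i with v ≟ i
      ... | yes refl = ≤-reflexive (trans (solve 1 (λ x → x :- con 1ℚ :* x := x :* con 0ℚ) refl (d v)) (cong (d v *_) (sym a-v)))
      ... | no v≢i = a≤a+b (0≤Σ (λ j → 0≤a*b (0≤weight adj i j) (0≤a j))) (begin
          d i - 0ℚ * d i + S          ≡⟨ cong (λ x → x - 0ℚ * d i + S) (trans (sym (Δa i (λ e → v≢i (sym e)))) (Δ-expand w a i)) ⟩
          d i * a i - S - 0ℚ * d i + S ≡⟨ solve 3 (λ x s y → x :- s :- con 0ℚ :* y :+ s := x) refl (d i * a i) S (d i) ⟩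
          d i * a i ∎)
        where
        open ≡-Reasoning
        S = Σℚ n (λ j → w i j * a j)
      T≥ : volume adj - d v ≤ T
      T≥ = subst (_≤ T) (trans (Σ-- d (λ i → δ v i * d i)) (cong (λ x → volume adj - x) (Σ-δ v d))) (Σ-mono pointwise)

    module _ {k : ℕ} {H : Adj k} (simple-H : IsSimple H) {V K : ℚ} (D : Decomposition adj v H V K) where
      open Decomposition D

      resistanceExcess : ℚ
      resistanceExcess = Σℚ k (excess H Q)

      -- Each pendant term equals `V` times the excess, plus `V - 1ℚ`, minus h, x and h x. The sums
      -- of h and of x agree by `Σx≡Σh`, which accounts for `volume H` being subtracted twice.
      kemeny′ : V * K ≡ V * Σℚ n (λ j → d j * R j j) - Σℚ n (λ j → d j * a j)
                      + (V * resistanceExcess + (ℕ→ℚ k * (V - 1ℚ) - volume H - volume H - ⟨ degree H , x ⟩))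
      kemeny′ = trans kemeny (cong (V * Σℚ n (λ j → d j * R j j) - Σℚ n (λ j → d j * a j) +_) (begin
        Σℚ k (λ p → (1ℚ + h p) * (V * Q p p - (1ℚ + x p)))
          ≡⟨ Σ-cong (λ p → solve 4 (λ V h q x → (con 1ℚ :+ h) :* (V :* q :- (con 1ℚ :+ x))
               := V :* ((con 1ℚ :+ h) :* q :- con 1ℚ) :+ (con (- 1ℚ) :* h :+ (con (- 1ℚ) :* x :+ (con (- 1ℚ) :* (h :* x) :+ (V :- con 1ℚ))))) refl V (h p) (Q p p) (x p)) ⟩
        Σℚ k (λ p → V * e p + (- 1ℚ * h p + (- 1ℚ * x p + (- 1ℚ * (h p * x p) + (V - 1ℚ)))))
          ≡⟨ trans (Σ-*+ V e (λ p → - 1ℚ * h p + (- 1ℚ * x p + (- 1ℚ * (h p * x p) + (V - 1ℚ))))) (cong (V * resistanceExcess +_)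
            (trans (Σ-*+ (- 1ℚ) h (λ p → - 1ℚ * x p + (- 1ℚ * (h p * x p) + (V - 1ℚ)))) (cong (- 1ℚ * volume H +_)
            (trans (Σ-*+ (- 1ℚ) x (λ p → - 1ℚ * (h p * x p) + (V - 1ℚ))) (cong₂ (λ y z → - 1ℚ * y + z) (Σx≡Σh H simple-H {x} Λx)
            (trans (Σ-*+ (- 1ℚ) (λ p → h p * x p) (λ _ → V - 1ℚ)) (cong (- 1ℚ * ⟨ h , x ⟩ +_) (Σ-const k (V - 1ℚ))))))))) ⟩
        V * resistanceExcess + (- 1ℚ * volume H + (- 1ℚ * volume H + (- 1ℚ * ⟨ h , x ⟩ + ℕ→ℚ k * (V - 1ℚ))))
          ≡⟨ cong (V * resistanceExcess +_) (solve 3 (λ η t y → con (- 1ℚ) :* η :+ (con (- 1ℚ) :* η :+ (con (- 1ℚ) :* t :+ y)) := y :- η :- η :- t) refl (volume H) ⟨ h , x ⟩ (ℕ→ℚ k * (V - 1ℚ))) ⟩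
        V * resistanceExcess + (ℕ→ℚ k * (V - 1ℚ) - volume H - volume H - ⟨ h , x ⟩) ∎))
        where
        open ≡-Reasoning
        h = degree H
        e = excess H Q

    noEdges-excess : ∀ {k V K} (D : Decomposition adj v (noEdges {k}) V K) → resistanceExcess noEdges-simple D ≡ 0ℚ
    noEdges-excess {k} D = trans (Σ-cong excess≡0) (Σ-zero k)
      where
      open Decomposition D
      Qpp≡1 : ∀ p → Q p p ≡ 1ℚ
      Qpp≡1 p = begin
        Q p p                                                  ≡⟨ +-identityʳ (Q p p) ⟨
        Q p p + 0ℚ                                             ≡⟨ cong (Q p p +_) (trans (Σ-cong (λ q → *-zeroˡ (Q p p - Q p q))) (Σ-zero k)) ⟨
        Λ (weight noEdges) (Q p) p                             ≡⟨ ΛQ p p ⟩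
        δ p p                                                  ≡⟨ δ-refl p ⟩
        1ℚ                                                     ∎
        where open ≡-Reasoning
      excess≡0 : ∀ p → excess noEdges Q p ≡ 0ℚ
      excess≡0 p = cong₂ (λ h q → (1ℚ + h) * q - 1ℚ) (noEdges-degree p) (Qpp≡1 p)

    kemeny-noEdges : ∀ {k V K} (D : Decomposition adj v (noEdges {k}) V K) → let open Decomposition D in
      V * K ≡ V * Σℚ n (λ j → d j * R j j) - Σℚ n (λ j → d j * a j) + ℕ→ℚ k * (V - 1ℚ)
    kemeny-noEdges {k} {V} D = trans (kemeny′ noEdges-simple D)
      (cong (V * Σℚ n (λ j → d j * R j j) - Σℚ n (λ j → d j * a j) +_)
        (trans (cong₂ (λ s η → V * s + (ℕ→ℚ k * (V - 1ℚ) - η - η - ⟨ degree noEdges , x ⟩)) (noEdges-excess D)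
          (noEdges-volume k))
        (trans (cong (λ t → V * 0ℚ + (ℕ→ℚ k * (V - 1ℚ) - 0ℚ - 0ℚ - t))
            (trans (Σ-cong (λ p → trans (cong (_* x p) (noEdges-degree p)) (*-zeroˡ (x p)))) (Σ-zero k)))
          (solve 2 (λ V y → V :* con 0ℚ :+ (y :- con 0ℚ :- con 0ℚ :- con 0ℚ) := y) refl V (ℕ→ℚ k * (V - 1ℚ))))))
      where open Decomposition D

    module _ {k : ℕ} (1≤k : 1 ℕ.≤ k) {m ℓ μ : ℚ} (volume-adj : volume adj ≡ m + m) {H : Adj k} (simple-H : IsSimple H) (volume-H : volume H ≡ ℓ + ℓ)
             (0≤m : 0ℚ ≤ m) (0<ℓ : 0ℚ < ℓ) (0≤μ : 0ℚ ≤ μ)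
             (component : Fin k → Fin k → Bool)
             (component-closed : ∀ p i j → H i j ≡ true → component p i ≡ component p j)
             (component-self : ∀ p → component p p ≡ true)
             (component-size : ∀ p → Σℚ k (λ u → bit (component p u)) ≤ μ)
             (threshold : ℕ→ℚ 3 * (μ + 1ℚ) < ℕ→ℚ 2 * (ℕ→ℚ 2 * m + ℕ→ℚ k))
             where

      private
        κ = ℕ→ℚ k
        V V′ : ℚ
        V  = m + m + κ + κ
        V′ = m + m + κ + (κ + (ℓ + ℓ))
        0<κ : 0ℚ < κ
        0<κ = 0<ℕ→ℚ 1≤k
        0≤m+m+κ : 0ℚ ≤ m + m + κ
        0≤m+m+κ = 0≤a+b (0≤a+b 0≤m 0≤m) (<⇒≤ 0<κ)
        0<V : 0ℚ < V
        0<V = +-mono-≤-< 0≤m+m+κ 0<κ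
        0<V′ : 0ℚ < V′
        0<V′ = +-mono-≤-< 0≤m+m+κ (<-≤-trans 0<κ (a≤a+b (0≤a+b (<⇒≤ 0<ℓ) (<⇒≤ 0<ℓ)) refl))

      decomposed-increase : ∀ {K K′} → Decomposition adj v (noEdges {k}) V K → Decomposition adj v H V′ K′ → K < K′
      decomposed-increase {K} {K′} D D′ = 0<b-a⇒a<b (0<a*b⇒0<b (0<a*b 0<V 0<V′) (subst (0ℚ <_) (sym difference) 0<difference))
        where
        open Decomposition D using (a; a-v; Δa; R; R-v; ΔR)
        open Decomposition D′ using (x; Q; ΛQ; Λx)
          renaming (a to a′; a-v to a′-v; Δa to Δa′; R to R′; R-v to R′-v; ΔR to ΔR′)
        r = Σℚ n (λ j → d j * R j j)
        T = Σℚ n (λ j → d j * a j)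
        s = resistanceExcess simple-H D′
        t = ⟨ degree H , x ⟩
        a≡a′ : ∀ i → a i ≡ a′ i
        a≡a′ = Δ-unique (trans a-v (sym a′-v)) (λ i i≢v → trans (Δa i i≢v) (sym (Δa′ i i≢v)))
        R≡R′ : ∀ j i → R j i ≡ R′ j i
        R≡R′ j = Δ-unique (trans (R-v j) (sym (R′-v j))) (λ i i≢v → trans (ΔR j i i≢v) (sym (ΔR′ j i i≢v)))
        kemeny-K′ : V′ * K′ ≡ V′ * r - T + (V′ * s + (κ * (V′ - 1ℚ) - (ℓ + ℓ) - (ℓ + ℓ) - t))
        kemeny-K′ = trans (kemeny′ simple-H D′) (cong₂ _+_
          (cong₂ (λ x y → V′ * x - y) (Σ-cong (λ j → cong (d j *_) (sym (R≡R′ j j)))) (Σ-cong (λ j → cong (d j *_) (sym (a≡a′ j)))))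
          (cong (λ η → V′ * s + (κ * (V′ - 1ℚ) - η - η - t)) volume-H))
        -- The resistance sum `r` cancels. The two copies of `volume H` give 4ℓ, and comparing κ / V
        -- with κ / V′ returns 2ℓκ = ℓV - 2mℓ after clearing denominators. This turns 4ℓ into 3ℓ and
        -- puts `m + m` beside `T + T`.
        difference : V * V′ * (K′ - K) ≡ ℓ * (T + T - (m + m)) + V * (V′ * s - (ℓ + ℓ + ℓ) - t)
        difference = begin
          V * V′ * (K′ - K)            ≡⟨ solve 4 (λ V V′ K K′ → V :* V′ :* (K′ :- K) := V :* (V′ :* K′) :- V′ :* (V :* K)) refl V V′ K K′ ⟩
          V * (V′ * K′) - V′ * (V * K) ≡⟨ cong₂ (λ x y → V * x - V′ * y) kemeny-K′ (kemeny-noEdges D) ⟩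
          V * (V′ * r - T + (V′ * s + (κ * (V′ - 1ℚ) - (ℓ + ℓ) - (ℓ + ℓ) - t))) - V′ * (V * r - T + κ * (V - 1ℚ))
            ≡⟨ solve 7 (λ m κ ℓ r T s t → let V = m :+ m :+ κ :+ κ ; V′ = m :+ m :+ κ :+ (κ :+ (ℓ :+ ℓ)) in
                 V :* (V′ :* r :- T :+ (V′ :* s :+ (κ :* (V′ :- con 1ℚ) :- (ℓ :+ ℓ) :- (ℓ :+ ℓ) :- t))) :- V′ :* (V :* r :- T :+ κ :* (V :- con 1ℚ))
                 := ℓ :* (T :+ T :- (m :+ m)) :+ V :* (V′ :* s :- (ℓ :+ ℓ :+ ℓ) :- t)) refl m κ ℓ r T s t ⟩
          ℓ * (T + T - (m + m)) + V * (V′ * s - (ℓ + ℓ + ℓ) - t) ∎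
          where open ≡-Reasoning
        t≤ : t ≤ (κ + (ℓ + ℓ)) * s
        t≤ = subst (λ η → t ≤ (κ + η) * s) volume-H (energy-bound H simple-H Q ΛQ x Λx 1≤k)
        s≥ : ℓ + ℓ ≤ (μ + 1ℚ) * s
        s≥ = subst (_≤ (μ + 1ℚ) * s) volume-H (subst (volume H ≤_) (Σ-* (μ + 1ℚ) (excess H Q))
          (Σ-mono (λ p → excess-bound H simple-H Q ΛQ (component p) (component-closed p) p (component-self p) μ 0≤μ (component-size p))))
        0<μ+1 : 0ℚ < μ + 1ℚ
        0<μ+1 = +-mono-≤-< 0≤μ (0<ℕ→ℚ {1} (ℕ.s≤s ℕ.z≤n))
        -- What remains of `V′ * s` once `(κ + (ℓ + ℓ)) * s` has been set aside for `t`. Multiplying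
        -- by `μ + 1ℚ` lets `s≥` and the threshold be used without dividing.
        0<pendant : 0ℚ < (m + m + κ) * s - (ℓ + ℓ + ℓ)
        0<pendant = 0<a*b⇒0<b 0<μ+1 (subst (0ℚ <_)
          (solve 5 (λ m κ ℓ μ s → (m :+ m :+ κ) :* ((μ :+ con 1ℚ) :* s :- (ℓ :+ ℓ)) :+ ℓ :* (con (ℕ→ℚ 2) :* (con (ℕ→ℚ 2) :* m :+ κ) :- con (ℕ→ℚ 3) :* (μ :+ con 1ℚ))
             := (μ :+ con 1ℚ) :* ((m :+ m :+ κ) :* s :- (ℓ :+ ℓ :+ ℓ))) refl m κ ℓ μ s)
          (+-mono-≤-< (0≤a*b 0≤m+m+κ (0≤b-a s≥)) (0<a*b 0<ℓ (0<b-a threshold))))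
        0<difference : 0ℚ < ℓ * (T + T - (m + m)) + V * (V′ * s - (ℓ + ℓ + ℓ) - t)
        0<difference = +-mono-≤-< (0≤a*b (<⇒≤ 0<ℓ) (0≤b-a (subst (_≤ T + T) volume-adj (hitting-moment a-v Δa))))
          (0<a*b 0<V (subst (0ℚ <_)
            (solve 5 (λ m κ ℓ s t → ((κ :+ (ℓ :+ ℓ)) :* s :- t) :+ ((m :+ m :+ κ) :* s :- (ℓ :+ ℓ :+ ℓ))
               := (m :+ m :+ κ :+ (κ :+ (ℓ :+ ℓ))) :* s :- (ℓ :+ ℓ :+ ℓ) :- t) refl m κ ℓ s t)
            (+-mono-≤-< (0≤b-a t≤) 0<pendant)))

      attached-increase : ∀ {G G′ : Adj (n ℕ.+ k)} → Attached adj v noEdges G → Attached adj v H G′ → KemenyIncreases G G′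
      attached-increase {G} {G′} att att′ M M′ hitting hitting′ i i′ = decomposed-increase
          (subst (λ V → Decomposition adj v noEdges V (kemenyFrom G M i)) vol (decompose att simple noEdges-simple walk hitting (subst (0ℚ <_) (sym vol) 0<V) i))
          (subst (λ V → Decomposition adj v H V (kemenyFrom G′ M′ i′)) vol′ (decompose att′ simple simple-H walk hitting′ (subst (0ℚ <_) (sym vol′) 0<V′) i′))
        where
        vol : volume G ≡ V
        vol = trans (attached-volume att simple noEdges-simple walk)
          (cong₂ (λ x y → x + κ + y) volume-adj (trans (cong (κ +_) (noEdges-volume k)) (+-identityʳ κ)))
        vol′ : volume G′ ≡ V′
        vol′ = trans (attached-volume att′ simple simple-H walk) (cong₂ (λ x y → x + κ + (κ + y)) volume-adj volume-H)

  addPendantPairs-increase : ∀ {n} {adj : Adj n} → IsSimple adj → Connected adj → (v : Fin n) → ∀ {k} → 1 ℕ.≤ k →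
    (L : List (Fin k × Fin k)) → All (λ pq → proj₁ pq ≢ proj₂ pq) L → AllPairs (λ a b → ¬ SamePair a b) L → 1 ℕ.≤ length L →
    ∀ μ → (∀ p → Σℚ k (λ u → bit (class L p u)) ≤ ℕ→ℚ μ) → 3 ℕ.* (μ ℕ.+ 1) ℕ.< 2 ℕ.* (2 ℕ.* edges adj ℕ.+ k) →
    KemenyIncreases (attachStar k adj v) (addPendantPairs {n} {k} (attachStar k adj v) L)
  addPendantPairs-increase {n} {adj} simple connected v {k} 1≤k L ne distinct 1≤l μ size≤μ threshold =
    attached-increase simple (λ i → connected i v) 1≤k (sym (handshake adj simple)) (memPair-simple L ne) (memPair-volume L ne distinct)
      (0≤ℕ→ℚ (edges adj)) (0<ℕ→ℚ 1≤l) (0≤ℕ→ℚ μ) (class L) (class-closed L) (class-self L) size≤μ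
      (subst₂ _<_ lhs rhs (ℕ→ℚ-mono-< threshold))
      (attachStar-attached k adj v) (addPendantPairs-attached L (attachStar-attached k adj v))
    where
    lhs : ℕ→ℚ (3 ℕ.* (μ ℕ.+ 1)) ≡ ℕ→ℚ 3 * (ℕ→ℚ μ + 1ℚ)
    lhs = trans (ℕ→ℚ-homo-* 3 (μ ℕ.+ 1)) (cong (ℕ→ℚ 3 *_) (ℕ→ℚ-homo-+ μ 1))
    rhs : ℕ→ℚ (2 ℕ.* (2 ℕ.* edges adj ℕ.+ k)) ≡ ℕ→ℚ 2 * (ℕ→ℚ 2 * ℕ→ℚ (edges adj) + ℕ→ℚ k)
    rhs = trans (ℕ→ℚ-homo-* 2 (2 ℕ.* edges adj ℕ.+ k)) (cong (ℕ→ℚ 2 *_)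
      (trans (ℕ→ℚ-homo-+ (2 ℕ.* edges adj) k) (cong (_+ ℕ→ℚ k) (ℕ→ℚ-homo-* 2 (edges adj)))))

-- The theorem: choice of the component bound.

open import Data.Nat using (ℕ; _+_; _*_; _^_; _≤_; _<_; _≥_; s≤s; z≤n; suc; _<?_)
open import Data.Nat.Properties using (≤-trans; ≮⇒≥; m≤n⇒m<n∨m≡n)
open import Data.Fin using (Fin)
open import Data.Product using (_×_; proj₁; proj₂)
open import Data.List using (List; length)
open import Data.List.Relation.Unary.All using (All)
open import Data.List.Relation.Unary.AllPairs using (AllPairs)
open import Relation.Nullary using (¬_; Dec; yes; no)
open import Relation.Binary.PropositionalEquality using (_≡_; _≢_)
open import Data.Sum using (_⊎_; inj₁; inj₂)
open import Data.Empty using (⊥-elim)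

theorem4p7 : (n : ℕ) (adj : Adj n) → IsSimple adj → Connected adj → (v : Fin n) →
    (k : ℕ) → 2 ≤ k →
    (L : List (Fin k × Fin k)) →
    All (λ pq → proj₁ pq ≢ proj₂ pq) L →
    AllPairs (λ a b → ¬ SamePair a b) L →
    1 ≤ length L →
    (length L < k →
    33 * length L ^ 2 + 50 * length L + 17 < (8 * edges adj + length L + 1) ^ 2) →
    (length L ≥ k →
    33 * k ^ 2 + 1 < (8 * edges adj + k + 1) ^ 2 + 30 * k) →
    KemenyIncreases (attachStar k adj v) (addPendantPairs (attachStar k adj v) L)
theorem4p7 n adj simple connected v k 2≤k L ne distinct 1≤l few many = by-cases (length L <? k) (m≤n⇒m<n∨m≡n 2≤k)
  where
  increase : ∀ μ → _ → _ → _
  increase = Comparison.addPendantPairs-increase simple connected v (≤-trans (s≤s z≤n) 2≤k) L ne distinct 1≤l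
  by-cases : Dec (length L < k) → 2 < k ⊎ 2 ≡ k → KemenyIncreases (attachStar k adj v) (addPendantPairs (attachStar k adj v) L)
  -- A component spanned by at most l edges has at most l + 1 vertices, which here is no worse than
  -- the trivial bound k used in the next case.
  by-cases (yes l<k) _ =
    increase (suc (length L)) (PairGraph.class-size L) (Threshold.few-pairs (edges adj) k (length L) 1≤l l<k (few l<k))
  by-cases (no l≮k) (inj₁ 2<k) =
    increase k (λ p → PairGraph.subset-size (PairGraph.class L p)) (Threshold.many-pairs (edges adj) k 2<k (many (≮⇒≥ l≮k)))
  -- With two pendant vertices there is only one pair to add, so l ≥ k cannot occur.
  by-cases (no l≮k) (inj₂ 2≡k) = ⊥-elim (l≮k (PairGraph.two-points 2≡k L ne distinct))
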